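{- Let $a<b$ be positive coprime integers. Then the number $N_{a,b}(n)$ of $(a,b)$-necklaces of length $n$ satisfies a linear homogeneous recurrence relation in $n$ of fixed order with integer coefficients; that is, there exist integers $d \ge 1$, $n_0$ and $c_1,\ldots,c_d$ (depending only on $a,b$) such that $N_{a,b}(n) = \sum_{i=1}^{d} c_i N_{a,b}(n-i)$ for all $n \ge n_0$.
   Context: For positive integers $a<b$ and $n \ge 3$, an $(a,b)$-necklace of length $n$ is a circular arrangement of the integers $0,1,\ldots,n-1$ (each used exactly once) such that any two adjacent entries have difference $\pm a$ or $\pm b$. Two necklaces are considered the same if one is obtained from the other by rotation or reflection of the circular arrangement. $N_{a,b}(n)$ denotes the number of distinct $(a,b)$-necklaces of length $n$; equivalently, it is the number of Hamiltonian cycles (as undirected subgraphs) of the graph $G_{a,b}(n)$ with vertex set $\{0,1,\ldots,n-1\}$ in which $x,y$ are adjacent if and only if $|x-y| \in \{a,b\}$. -}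

module Defs where

open import Data.Nat.Base using (ℕ; suc; _+_; ∣_-_∣; _^_)
open import Data.Nat.Properties using () renaming (_≟_ to _≟ℕ_)
open import Data.Nat.DivMod using (_mod_)
open import Data.Fin.Base using (Fin; toℕ; opposite; finToFun)
open import Data.Fin.Properties using (_≟_; any?; all?)
open import Data.List.Base using (List; map; filter; deduplicate; length; allFin)
open import Data.Product using (_×_; ∃; ∃!)
open import Data.Sum.Base using (_⊎_)
open import Data.Vec.Functional using (Vector)
open import Relation.Binary.PropositionalEquality using (_≡_)
open import Relation.Nullary.Decidable using (Dec; map′; _×-dec_; _⊎-dec_; _→-dec_)

-- The n places of the circle are Fin n, in cyclic order; the entries
-- 0, …, n - 1 are Fin n as well.

Arrangement : ℕ → Set
Arrangement n = Vector (Fin n) n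

_⊕_ : ∀ {n} → Fin n → Fin n → Fin n
_⊕_ {suc m} k i = (toℕ k + toℕ i) mod suc m

next : ∀ {n} → Fin n → Fin n
next {suc m} i = suc (toℕ i) mod suc m

EachOnce : ∀ {n} → Arrangement n → Set
EachOnce σ = ∀ x → ∃! _≡_ λ i → σ i ≡ x

Adjacent : ℕ → ℕ → ℕ → ℕ → Set
Adjacent a b x y = ∣ x - y ∣ ≡ a ⊎ ∣ x - y ∣ ≡ b

IsNecklace : ∀ (a b : ℕ) {n} → Arrangement n → Set
IsNecklace a b σ =
  EachOnce σ × (∀ i → Adjacent a b (toℕ (σ i)) (toℕ (σ (next i))))

-- opposite i = n - 1 - i, so the second alternative runs over all
-- reflections of the circle.

_∼_ : ∀ {n} → Arrangement n → Arrangement n → Set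
σ ∼ τ = ∃ λ k → (∀ i → τ i ≡ σ (k ⊕ i)) ⊎ (∀ i → τ i ≡ σ (k ⊕ opposite i))

eachOnce? : ∀ {n} (σ : Arrangement n) → Dec (EachOnce σ)
eachOnce? σ = all? λ x → any? λ i → (σ i ≟ x) ×-dec
  map′ (λ u {j} → u j) (λ u j → u {j}) (all? λ j → (σ j ≟ x) →-dec (i ≟ j))

isNecklace? : ∀ (a b : ℕ) {n} (σ : Arrangement n) → Dec (IsNecklace a b σ)
isNecklace? a b σ = eachOnce? σ ×-dec all? λ i →
  (∣ toℕ (σ i) - toℕ (σ (next i)) ∣ ≟ℕ a) ⊎-dec
  (∣ toℕ (σ i) - toℕ (σ (next i)) ∣ ≟ℕ b)

_∼?_ : ∀ {n} (σ τ : Arrangement n) → Dec (σ ∼ τ)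
σ ∼? τ = any? λ k →
  all? (λ i → τ i ≟ σ (k ⊕ i)) ⊎-dec all? (λ i → τ i ≟ σ (k ⊕ opposite i))

-- finToFun is the bijection from Fin (n ^ n) to the maps Fin n → Fin n,
-- so every arrangement is listed exactly once.

arrangements : ∀ n → List (Arrangement n)
arrangements n = map finToFun (allFin (n ^ n))

-- The first member of each ∼-class of necklaces is kept, so the length is
-- the number of classes.  Meaningful for 3 ≤ n.

N : ℕ → ℕ → ℕ → ℕ
N a b n = length (deduplicate _∼?_ (filter (isNecklace? a b) (arrangements n)))

{-# OPTIONS --safe #-}
module Submission where

open import Defs
open import Data.Nat.Base as ℕ using (ℕ; zero; suc; _∸_; _≤_; _<_; z≤n; s≤s; _≡ᵇ_; ∣_-_∣; _^_)
import Data.Nat.Properties as ℕ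
open import Data.Nat.Coprimality using (Coprime)
open import Data.Nat.DivMod using (_%_; m<n⇒m%n≡m; n%n≡0; %-distribˡ-+; m%n%n≡m%n)
open import Data.Integer.Base using (ℤ; +_; _+_; _*_; 0ℤ; 1ℤ; -1ℤ)
import Data.Integer.Properties as ℤ
open import Data.Integer.Properties using (+-0-commutativeMonoid)
open import Data.Integer.Tactic.RingSolver using (solve-∀)
open import Algebra.Properties.CommutativeMonoid.Sum +-0-commutativeMonoid
  using (sum; sum-cong-≗; sum-remove; sum-replicate-zero; sum-permute; ∑-distrib-+; ∑-comm)
open import Algebra.Properties.Semiring.Sum ℤ.+-*-semiring using (*-distribˡ-sum; *-distribʳ-sum)
open import Data.Bool.Base using (Bool; true; false; if_then_else_; _∧_; _∨_; T)
open import Data.Bool.Properties using (T?; T-∧; T-∨; ∧-zeroʳ)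
open import Data.Fin.Base
  using (Fin; zero; suc; toℕ; fromℕ; fromℕ<; inject₁; opposite; punchIn; punchOut; finToFun;
         funToFin)
open import Data.Fin.Induction using (<-weakInduction; >-weakInduction)
import Data.Fin.Permutation as Perm
open import Data.Fin.Properties as Fin
  using (_≟_; all?; punchIn-punchOut; punchInᵢ≢i; toℕ-injective; toℕ-fromℕ; toℕ-fromℕ<;
         toℕ-inject₁; toℕ<n; opposite-involutive; opposite-prop; finToFun-funToFin)
open import Data.Fin.Relation.Unary.Top using (view; ‵fromℕ; ‵inject₁)
open import Data.List.Base as List
  using (List; []; _∷_; [_]; allFin; tabulate; filter; deduplicate; length; lookup;
         cartesianProduct)
open import Data.List.Membership.Propositional using (_∈_; find; lose)
open import Data.List.Membership.Propositional.Properties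
  using (∈-map⁺; ∈-allFin; ∈-filter⁺; ∈-filter⁻; ∈-lookup; ∈-cartesianProduct⁺)
open import Data.List.Relation.Unary.All as All using ([]; _∷_)
import Data.List.Relation.Unary.All.Properties as All
open import Data.List.Relation.Unary.AllPairs using (AllPairs; []; _∷_)
import Data.List.Relation.Unary.AllPairs.Properties as AllPairs
open import Data.List.Relation.Unary.Any as Any using (here)
import Data.List.Relation.Unary.Any.Properties as Any
open import Data.List.Relation.Unary.Unique.Propositional using (Unique)
import Data.List.Relation.Unary.Unique.Propositional.Properties as Unique
open import Data.Product.Base using (_×_; _,_; ∃; ∃-syntax; Σ-syntax; proj₁; proj₂)
open import Data.Sum.Base using (_⊎_; inj₁; inj₂)
open import Data.Empty using (⊥)
open import Data.Unit.Base using (⊤; tt)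
open import Data.Vec.Base as Vec using (Vec; []; _∷_)
open import Function.Base using (_∘_; id)
open import Function.Bundles using (_⇔_; mk⇔; module Equivalence)
open import Relation.Nullary using (Dec; does; yes; no; ¬_; ¬?; contradiction; _×-dec_)
open import Relation.Nullary.Decidable using (dec-true; dec-false; does-⇔)
open import Relation.Binary.Definitions using (Decidable; tri<; tri≈; tri>)
import Relation.Unary as Unary
open import Relation.Binary.PropositionalEquality hiding ([_])

open ≡-Reasoning

-- Insert the vertices of a directed cycle one at a time: on {0, …, m} the cycles
-- are the pairs of a cycle on {1, …, m} and the vertex after which 0 is inserted.
-- Hence the number of Hamiltonian cycles of a digraph is the sum, over the pairs
-- p → 0 → q, of the number of Hamiltonian cycles of the digraph without 0 in which
-- q is the only out-neighbour of p.  Starting from the graph with differences a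
-- and b, the digraphs so obtained differ from it only in a fixed window near 0, so
-- there are finitely many of them and the counts form a linear system x(m + 1) =
-- M x(m) over ℤ.  Eliminating the unknowns one by one, with the shift acting as
-- an indeterminate, leaves a monic recurrence for each of them.  Orienting every
-- necklace so that 0 is followed by a makes each class correspond to one cycle.

-- Indicators and finite sums.

⟨_⟩ : Bool → ℤ
⟨ b ⟩ = if b then 1ℤ else 0ℤ

δ : ∀ {n} → Fin n → Fin n → ℤ
δ i j = ⟨ does (i ≟ j) ⟩

sum-zero : ∀ {n} {f : Fin n → ℤ} → (∀ i → f i ≡ 0ℤ) → sum f ≡ 0ℤ
sum-zero {n} f≗0 = trans (sum-cong-≗ f≗0) (sum-replicate-zero n)

sum-single : ∀ {n} (i : Fin n) (f : Fin n → ℤ) → (∀ j → j ≢ i → f j ≡ 0ℤ) → sum f ≡ f i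
sum-single {suc n} i f f≗0 = begin
  sum f                          ≡⟨ sum-remove {i = i} f ⟩
  f i + sum (f ∘ punchIn i)      ≡⟨ cong (_+_ (f i)) (sum-zero (λ j → f≗0 _ (punchInᵢ≢i i j))) ⟩
  f i + 0ℤ                       ≡⟨ ℤ.+-identityʳ (f i) ⟩
  f i                            ∎

sum-δ : ∀ {n} (i : Fin n) (f : Fin n → ℤ) → sum (λ j → δ i j * f j) ≡ f i
sum-δ i f = begin
  sum (λ j → δ i j * f j) ≡⟨ sum-single i _ (λ j j≢i → cong (λ b → ⟨ b ⟩ * f j) (dec-false (i ≟ j) (≢-sym j≢i))) ⟩
  δ i i * f i             ≡⟨ cong (λ b → ⟨ b ⟩ * f i) (dec-true (i ≟ i) refl) ⟩
  1ℤ * f i                ≡⟨ ℤ.*-identityˡ (f i) ⟩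
  f i                     ∎

-- Integer polynomials in the shift operator.

-- Polynomials of degree < D, by coefficients in increasing order, acting on
-- sequences with the indeterminate as the shift.

Sequence : Set
Sequence = ℕ → ℤ

⟦_⟧ : ∀ {D} → Vec ℤ D → Sequence → Sequence
⟦ []    ⟧ y m = 0ℤ
⟦ c ∷ v ⟧ y m = c * y m + ⟦ v ⟧ y (suc m)

module _ where
  private variable
    D D′ : ℕ

  scale : ℤ → Vec ℤ D → Vec ℤ D
  scale c = Vec.map (c *_)

  _⊞_ : Vec ℤ D → Vec ℤ D → Vec ℤ D
  _⊞_ = Vec.zipWith _+_

  extend : D ≤ D′ → Vec ℤ D → Vec ℤ D′
  extend z≤n       []      = Vec.replicate _ 0ℤ
  extend (s≤s D≤D′) (c ∷ v) = c ∷ extend D≤D′ v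

  shift : ∀ k → Vec ℤ D → Vec ℤ (k ℕ.+ D)
  shift k v = Vec.replicate k 0ℤ Vec.++ v

  -- The length `D + D′` is chosen over the sharper `D + D′ - 1` to avoid subtraction; for two
  -- factors of length `D` it matches `shift D`, so that the terms of an elimination step can be
  -- added.
  _⊠_ : Vec ℤ D → Vec ℤ D′ → Vec ℤ (D ℕ.+ D′)
  _⊠_ []      w = Vec.replicate _ 0ℤ
  _⊠_ {suc D} {D′} (c ∷ v) w = extend (ℕ.m≤n+m D′ (suc D)) (scale c w) ⊞ shift 1 (v ⊠ w)

  ⟦⟧-cong : (v : Vec ℤ D) {y z : Sequence} → y ≗ z → ⟦ v ⟧ y ≗ ⟦ v ⟧ z
  ⟦⟧-cong []      y≗z m = refl
  ⟦⟧-cong (c ∷ v) y≗z m = cong₂ _+_ (cong (c *_) (y≗z m)) (⟦⟧-cong v y≗z (suc m))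

  ⟦⟧-+ : (v : Vec ℤ D) (y z : Sequence) → ∀ m →
         ⟦ v ⟧ (λ k → y k + z k) m ≡ ⟦ v ⟧ y m + ⟦ v ⟧ z m
  ⟦⟧-+ []      y z m = refl
  ⟦⟧-+ (c ∷ v) y z m rewrite ⟦⟧-+ v y z (suc m) = lem c (y m) (z m) (⟦ v ⟧ y (suc m)) (⟦ v ⟧ z (suc m))
    where
    lem : ∀ c y z v w → c * (y + z) + (v + w) ≡ (c * y + v) + (c * z + w)
    lem = solve-∀

  ⟦⟧-* : (v : Vec ℤ D) (c : ℤ) (y : Sequence) → ∀ m →
         ⟦ v ⟧ (λ k → c * y k) m ≡ c * ⟦ v ⟧ y m
  ⟦⟧-* []      c y m = sym (ℤ.*-zeroʳ c)
  ⟦⟧-* (d ∷ v) c y m rewrite ⟦⟧-* v c y (suc m) = lem c d (y m) (⟦ v ⟧ y (suc m))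
    where
    lem : ∀ c d y v → d * (c * y) + c * v ≡ c * (d * y + v)
    lem = solve-∀

  ⟦⟧-0 : (v : Vec ℤ D) → ∀ m → ⟦ v ⟧ (λ _ → 0ℤ) m ≡ 0ℤ
  ⟦⟧-0 v m = ⟦⟧-* v 0ℤ (λ _ → 0ℤ) m

  ⟦⟧-sum : ∀ {n} (v : Vec ℤ D) (y : Fin n → Sequence) → ∀ m →
           ⟦ v ⟧ (λ k → sum (λ i → y i k)) m ≡ sum (λ i → ⟦ v ⟧ (y i) m)
  ⟦⟧-sum {n = zero}  v y m = ⟦⟧-0 v m
  ⟦⟧-sum {n = suc n} v y m = trans (⟦⟧-+ v (y zero) _ m) (cong (_+_ (⟦ v ⟧ (y zero) m)) (⟦⟧-sum v (y ∘ suc) m))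

  ⟦⟧-shift : (v : Vec ℤ D) (y : Sequence) → ∀ k m → ⟦ v ⟧ (λ l → y (l ℕ.+ k)) m ≡ ⟦ v ⟧ y (m ℕ.+ k)
  ⟦⟧-shift []      y k m = refl
  ⟦⟧-shift (c ∷ v) y k m = cong (_+_ (c * y (m ℕ.+ k))) (⟦⟧-shift v y k (suc m))

  ⟦⟧-suc : (v : Vec ℤ D) (y : Sequence) → ∀ m → ⟦ v ⟧ (y ∘ suc) m ≡ ⟦ v ⟧ y (suc m)
  ⟦⟧-suc []      y m = refl
  ⟦⟧-suc (c ∷ v) y m = cong (_+_ (c * y (suc m))) (⟦⟧-suc v y (suc m))

  -- The coefficients are constants, so every operator commutes with the shift and hence with every
  -- other operator. The cancellation in the elimination step rests on this.
  ⟦⟧-comm : (v : Vec ℤ D) (w : Vec ℤ D′) (y : Sequence) → ⟦ v ⟧ (⟦ w ⟧ y) ≗ ⟦ w ⟧ (⟦ v ⟧ y)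
  ⟦⟧-comm []      w y m = sym (⟦⟧-0 w m)
  ⟦⟧-comm (c ∷ v) w y m = begin
    c * ⟦ w ⟧ y m + ⟦ v ⟧ (⟦ w ⟧ y) (suc m)
      ≡⟨ cong₂ _+_ (sym (⟦⟧-* w c y m)) (⟦⟧-comm v w y (suc m)) ⟩
    ⟦ w ⟧ (λ k → c * y k) m + ⟦ w ⟧ (⟦ v ⟧ y) (suc m)
      ≡⟨ cong (_+_ (⟦ w ⟧ (λ k → c * y k) m)) (⟦⟧-suc w (⟦ v ⟧ y) m) ⟨
    ⟦ w ⟧ (λ k → c * y k) m + ⟦ w ⟧ (⟦ v ⟧ y ∘ suc) m            ≡⟨ ⟦⟧-+ w _ _ m ⟨
    ⟦ w ⟧ (⟦ c ∷ v ⟧ y) m                                        ∎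

  ⟦scale⟧ : ∀ c (v : Vec ℤ D) y m → ⟦ scale c v ⟧ y m ≡ c * ⟦ v ⟧ y m
  ⟦scale⟧ c []      y m = sym (ℤ.*-zeroʳ c)
  ⟦scale⟧ c (d ∷ v) y m rewrite ⟦scale⟧ c v y (suc m) = lem c d (y m) (⟦ v ⟧ y (suc m))
    where
    lem : ∀ c d y v → c * d * y + c * v ≡ c * (d * y + v)
    lem = solve-∀

  ⟦⊞⟧ : ∀ (v w : Vec ℤ D) y m → ⟦ v ⊞ w ⟧ y m ≡ ⟦ v ⟧ y m + ⟦ w ⟧ y m
  ⟦⊞⟧ []      []      y m = refl
  ⟦⊞⟧ (c ∷ v) (d ∷ w) y m rewrite ⟦⊞⟧ v w y (suc m) = lem c d (y m) (⟦ v ⟧ y (suc m)) (⟦ w ⟧ y (suc m))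
    where
    lem : ∀ c d y v w → (c + d) * y + (v + w) ≡ (c * y + v) + (d * y + w)
    lem = solve-∀

  ⟦0⟧ : ∀ k y m → ⟦ Vec.replicate k 0ℤ ⟧ y m ≡ 0ℤ
  ⟦0⟧ zero    y m = refl
  ⟦0⟧ (suc k) y m = trans (ℤ.+-identityˡ _) (⟦0⟧ k y (suc m))

  ⟦extend⟧ : ∀ (D≤D′ : D ≤ D′) v y m → ⟦ extend D≤D′ v ⟧ y m ≡ ⟦ v ⟧ y m
  ⟦extend⟧ {D′ = D′} z≤n []   y m = ⟦0⟧ D′ y m
  ⟦extend⟧ (s≤s D≤D′) (c ∷ v) y m = cong (_+_ (c * y m)) (⟦extend⟧ D≤D′ v y (suc m))

  ⟦shift⟧ : ∀ k (v : Vec ℤ D) y m → ⟦ shift k v ⟧ y m ≡ ⟦ v ⟧ y (m ℕ.+ k)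
  ⟦shift⟧ zero    v y m = cong (⟦ v ⟧ y) (sym (ℕ.+-identityʳ m))
  ⟦shift⟧ (suc k) v y m = begin
    0ℤ + ⟦ shift k v ⟧ y (suc m) ≡⟨ ℤ.+-identityˡ _ ⟩
    ⟦ shift k v ⟧ y (suc m)      ≡⟨ ⟦shift⟧ k v y (suc m) ⟩
    ⟦ v ⟧ y (suc m ℕ.+ k)        ≡⟨ cong (⟦ v ⟧ y) (ℕ.+-suc m k) ⟨
    ⟦ v ⟧ y (m ℕ.+ suc k)        ∎

  ⟦⊠⟧ : ∀ (v : Vec ℤ D) (w : Vec ℤ D′) y m → ⟦ v ⊠ w ⟧ y m ≡ ⟦ v ⟧ (⟦ w ⟧ y) m
  ⟦⊠⟧ {D′ = D′} []      w y m = ⟦0⟧ D′ y m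
  ⟦⊠⟧ {suc D} {D′} (c ∷ v) w y m = begin
    ⟦ extend D′≤ (scale c w) ⊞ shift 1 (v ⊠ w) ⟧ y m         ≡⟨ ⟦⊞⟧ (extend D′≤ (scale c w)) (shift 1 (v ⊠ w)) y m ⟩
    ⟦ extend D′≤ (scale c w) ⟧ y m + ⟦ shift 1 (v ⊠ w) ⟧ y m
      ≡⟨ cong₂ _+_ (⟦extend⟧ D′≤ (scale c w) y m) (ℤ.+-identityˡ _) ⟩
    ⟦ scale c w ⟧ y m + ⟦ v ⊠ w ⟧ y (suc m)                ≡⟨ cong₂ _+_ (⟦scale⟧ c w y m) (⟦⊠⟧ v w y (suc m)) ⟩
    c * ⟦ w ⟧ y m + ⟦ v ⟧ (⟦ w ⟧ y) (suc m)                ∎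
    where
    D′≤ = ℕ.m≤n+m D′ (suc D)

-- Elimination of unknowns from linear shift systems.

-- A system E^D y = W y, with E the shift and W a matrix of polynomials of
-- degree < D.
Solves : ∀ {n D} → (Fin n → Fin n → Vec ℤ D) → (Fin n → Sequence) → Set
Solves {D = D} W y = ∀ i m → y i (m ℕ.+ D) ≡ sum (λ j → ⟦ W i j ⟧ (y j) m)

module _ {n D : ℕ} (W : Fin (suc n) → Fin (suc n) → Vec ℤ D) (r : Fin (suc n)) where

  -- Put `A = E^D I - W`. The entries of `E^(2D) I - eliminate` are the minors
  -- `A r r * A i′ j′ - A i′ r * A r j′`: elimination without fractions, pivoting on `(r , r)`. The
  -- diagonal of `A` is monic of degree `D`, so the new system is again monic, of degree `2D`.
  eliminate : Fin n → Fin n → Vec ℤ (D ℕ.+ D)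
  eliminate i j =
    (shift D (W i′ j′) ⊞ (W i′ r ⊠ W r j′)) ⊞
    (scale -1ℤ (W r r ⊠ W i′ j′) ⊞ scale (δ i j) (shift D (W r r)))
    where
    i′ j′ : Fin (suc n)
    i′ = punchIn r i
    j′ = punchIn r j

  -- Row i times the (r, r) entry of E^D - W, plus row r times W i r.  Since the
  -- entries commute, the terms in y r cancel.
  eliminate-solves : ∀ {y} → Solves W y → Solves eliminate (y ∘ punchIn r)
  eliminate-solves {y} solves i m = begin
    y i′ (m ℕ.+ (D ℕ.+ D))                                  ≡⟨ cong (y i′) (ℕ.+-assoc m D D) ⟨
    y i′ (m ℕ.+ D ℕ.+ D)                                    ≡⟨ row i′ (m ℕ.+ D) ⟩
    ⟦ W i′ r ⟧ (y r) (m ℕ.+ D) + S₁                         ≡⟨ cong (_+ S₁) y-r ⟩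
    -- Adding and subtracting `S₃` completes `X` to `X + S₃`, which row `i′` identifies with `W r r`
    -- applied to `E^D y i′`. This removes the last term in `y r` and accounts for the `δ` entry.
    (X + S₂) + S₁                                           ≡⟨ arith X S₁ S₂ S₃ ⟩
    (S₁ + S₂) + (-1ℤ * S₃ + (X + S₃))                       ≡⟨ cong (λ z → (S₁ + S₂) + (-1ℤ * S₃ + z)) y-i ⟨
    (S₁ + S₂) + (-1ℤ * S₃ + ⟦ W r r ⟧ (y i′) (m ℕ.+ D))     ≡⟨ entries ⟨
    sum (λ j → ⟦ eliminate i j ⟧ (y (punchIn r j)) m)       ∎
    where
    i′ = punchIn r i
    X S₁ S₂ S₃ : ℤ
    X  = ⟦ W r r ⟧ (⟦ W i′ r ⟧ (y r)) m
    S₁ = sum (λ j → ⟦ W i′ (punchIn r j) ⟧ (y (punchIn r j)) (m ℕ.+ D))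
    S₂ = sum (λ j → ⟦ W i′ r ⟧ (⟦ W r (punchIn r j) ⟧ (y (punchIn r j))) m)
    S₃ = sum (λ j → ⟦ W r r ⟧ (⟦ W i′ (punchIn r j) ⟧ (y (punchIn r j))) m)

    row : ∀ k l → y k (l ℕ.+ D) ≡ ⟦ W k r ⟧ (y r) l + sum (λ j → ⟦ W k (punchIn r j) ⟧ (y (punchIn r j)) l)
    row k l = trans (solves k l) (sum-remove {i = r} (λ j → ⟦ W k j ⟧ (y j) l))

    expand : ∀ {D′} (v : Vec ℤ D′) k → ⟦ v ⟧ (y k) (m ℕ.+ D) ≡
             ⟦ v ⟧ (⟦ W k r ⟧ (y r)) m + sum (λ j → ⟦ v ⟧ (⟦ W k (punchIn r j) ⟧ (y (punchIn r j))) m)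
    expand v k = begin
      ⟦ v ⟧ (y k) (m ℕ.+ D)                  ≡⟨ ⟦⟧-shift v (y k) D m ⟨
      ⟦ v ⟧ (λ l → y k (l ℕ.+ D)) m          ≡⟨ ⟦⟧-cong v (row k) m ⟩
      ⟦ v ⟧ (λ l → ⟦ W k r ⟧ (y r) l + sum (λ j → ⟦ W k (punchIn r j) ⟧ (y (punchIn r j)) l)) m
                                             ≡⟨ ⟦⟧-+ v _ _ m ⟩
      ⟦ v ⟧ (⟦ W k r ⟧ (y r)) m + ⟦ v ⟧ (λ l → sum (λ j → ⟦ W k (punchIn r j) ⟧ (y (punchIn r j)) l)) m
                                             ≡⟨ cong (_+_ (⟦ v ⟧ (⟦ W k r ⟧ (y r)) m)) (⟦⟧-sum v (λ j → ⟦ W k (punchIn r j) ⟧ (y (punchIn r j))) m) ⟩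
      ⟦ v ⟧ (⟦ W k r ⟧ (y r)) m + sum (λ j → ⟦ v ⟧ (⟦ W k (punchIn r j) ⟧ (y (punchIn r j))) m) ∎

    y-r : ⟦ W i′ r ⟧ (y r) (m ℕ.+ D) ≡ X + S₂
    y-r = trans (expand (W i′ r) r) (cong (_+ S₂) (⟦⟧-comm (W i′ r) (W r r) (y r) m))

    y-i : ⟦ W r r ⟧ (y i′) (m ℕ.+ D) ≡ X + S₃
    y-i = expand (W r r) i′

    arith : ∀ x s₁ s₂ s₃ → (x + s₂) + s₁ ≡ (s₁ + s₂) + (-1ℤ * s₃ + (x + s₃))
    arith = solve-∀

    entry : ∀ j → let j′ = punchIn r j in
            ⟦ eliminate i j ⟧ (y j′) m ≡
            (⟦ W i′ j′ ⟧ (y j′) (m ℕ.+ D) + ⟦ W i′ r ⟧ (⟦ W r j′ ⟧ (y j′)) m) +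
            (-1ℤ * ⟦ W r r ⟧ (⟦ W i′ j′ ⟧ (y j′)) m + δ i j * ⟦ W r r ⟧ (y j′) (m ℕ.+ D))
    entry j = trans
      (⟦⊞⟧ (shift D (W i′ j′) ⊞ (W i′ r ⊠ W r j′))
           (scale -1ℤ (W r r ⊠ W i′ j′) ⊞ scale (δ i j) (shift D (W r r))) (y j′) m)
      (cong₂ _+_
      (trans (⟦⊞⟧ (shift D (W i′ j′)) (W i′ r ⊠ W r j′) (y j′) m)
        (cong₂ _+_ (⟦shift⟧ D (W i′ j′) (y j′) m) (⟦⊠⟧ (W i′ r) (W r j′) (y j′) m)))
      (trans (⟦⊞⟧ (scale -1ℤ (W r r ⊠ W i′ j′)) (scale (δ i j) (shift D (W r r))) (y j′) m) (cong₂ _+_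
        (trans (⟦scale⟧ -1ℤ (W r r ⊠ W i′ j′) (y j′) m) (cong (-1ℤ *_) (⟦⊠⟧ (W r r) (W i′ j′) (y j′) m)))
        (trans (⟦scale⟧ (δ i j) (shift D (W r r)) (y j′) m) (cong (δ i j *_) (⟦shift⟧ D (W r r) (y j′) m))))))
      where j′ = punchIn r j

    entries : sum (λ j → ⟦ eliminate i j ⟧ (y (punchIn r j)) m) ≡
              (S₁ + S₂) + (-1ℤ * S₃ + ⟦ W r r ⟧ (y i′) (m ℕ.+ D))
    entries = trans (sum-cong-≗ entry) (trans (∑-distrib-+ {n = n} _ _) (cong₂ _+_
      (∑-distrib-+ {n = n} _ _)
      (trans (∑-distrib-+ {n = n} _ _) (cong₂ _+_
        (sym (*-distribˡ-sum {n = n} -1ℤ _))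
        (sum-δ i (λ j → ⟦ W r r ⟧ (y (punchIn r j)) (m ℕ.+ D)))))))

Recurrent : Sequence → Set
Recurrent y = ∃[ D ] Σ[ v ∈ Vec ℤ D ] (1 ≤ D × (∀ m → y (m ℕ.+ D) ≡ ⟦ v ⟧ y m))

-- Eliminating one unknown other than `t` at a time leaves a single equation for `y t`, which is the
-- recurrence. The order doubles at each step.
solution-recurrent : ∀ {n D} (W : Fin (suc n) → Fin (suc n) → Vec ℤ D) y → 1 ≤ D →
                     Solves W y → ∀ t → Recurrent (y t)
solution-recurrent {zero} W y 1≤D solves zero =
  _ , W zero zero , 1≤D , λ m → trans (solves zero m) (ℤ.+-identityʳ _)
solution-recurrent {suc n} {D} W y 1≤D solves t =
  subst (Recurrent ∘ y) (punchIn-punchOut r≢t)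
    (solution-recurrent (eliminate W r) (y ∘ punchIn r) (ℕ.≤-trans 1≤D (ℕ.m≤m+n D D))
      (eliminate-solves W r {y} solves) (punchOut r≢t))
  where
  -- Any index other than `t`; one exists because at least two unknowns are left.
  r = punchIn t zero
  r≢t : r ≢ t
  r≢t = punchInᵢ≢i t zero

-- Constants are polynomials of degree below 1, so the system has `D = 1`. This does the work of
-- Cayley-Hamilton, with an order that may be larger.
linear-recurrent : ∀ {n} (M : Fin n → Fin n → ℤ) {y : Fin n → Sequence} →
                   (∀ i m → y i (suc m) ≡ sum (λ j → M i j * y j m)) → ∀ t → Recurrent (y t)
linear-recurrent {suc n} M {y} step = solution-recurrent (λ i j → M i j ∷ []) y (s≤s z≤n) λ i m → begin
  y i (m ℕ.+ 1)                            ≡⟨ cong (y i) (ℕ.+-comm m 1) ⟩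
  y i (suc m)                              ≡⟨ step i m ⟩
  sum (λ j → M i j * y j m)                ≡⟨ sum-cong-≗ (λ j → ℤ.+-identityʳ (M i j * y j m)) ⟨
  sum (λ j → M i j * y j m + 0ℤ)           ∎

⟦⟧-as-sum : ∀ {D} (v : Vec ℤ D) y m → ⟦ v ⟧ y m ≡ sum (λ i → Vec.lookup v i * y (m ℕ.+ toℕ i))
⟦⟧-as-sum []      y m = refl
⟦⟧-as-sum (c ∷ v) y m = cong₂ _+_ (cong (λ k → c * y k) (sym (ℕ.+-identityʳ m)))
  (trans (⟦⟧-as-sum v y (suc m)) (sum-cong-≗ (λ i → cong (λ k → Vec.lookup v i * y k) (sym (ℕ.+-suc m (toℕ i))))))

-- Directed Hamiltonian cycles coded by insertion.

-- (c , p) stands for the cycle c with its vertices renamed by suc and zero inserted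
-- after suc p.
Code : ℕ → Set
Code zero    = ⊤
Code (suc m) = Code m × Fin (suc m)

-- The successor map of the coded cycle. The cycle on one vertex is a loop, from which insertion
-- builds all the others.
follow : ∀ {m} → Code m → Fin (suc m) → Fin (suc m)
follow {zero}  _       i       = i
follow {suc m} (c , p) zero    = suc (follow c p)
follow {suc m} (c , p) (suc i) = if does (i ≟ p) then zero else suc (follow c i)

follow-pivot : ∀ {m} (c : Code m) p → follow (c , p) (suc p) ≡ zero
follow-pivot c p rewrite dec-true (p ≟ p) refl = refl

follow-other : ∀ {m} (c : Code m) {p i} → i ≢ p → follow (c , p) (suc i) ≡ suc (follow c i)
follow-other c {p} {i} i≢p rewrite dec-false (i ≟ p) i≢p = refl

codes : ∀ m → List (Code m)
codes zero    = [ tt ]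
codes (suc m) = cartesianProduct (codes m) (allFin (suc m))

-- Contraction of a digraph at vertex 0.

Digraph : Set
Digraph = ℕ → ℕ → Bool

_Follows_ : ∀ {m} → Code m → Digraph → Set
c Follows R = ∀ i → T (R (toℕ i) (toℕ (follow c i)))

follows? : ∀ {m} R (c : Code m) → Dec (c Follows R)
follows? R c = all? λ i → T? (R (toℕ i) (toℕ (follow c i)))

-- The arc `p → q` stands for the path `suc p → 0 → suc q` and is present whether or not `R` has an
-- arc from `suc p` to `suc q`. All other arcs out of `p` are dropped, so a cycle of the contraction
-- has to use it.
contract : Digraph → ℕ → ℕ → Digraph
contract R p q i j = if i ≡ᵇ p then j ≡ᵇ q else R (suc i) (suc j)

passes : Digraph → ℕ → ℕ → Bool
passes R p q = R (suc p) 0 ∧ R 0 (suc q)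

≡ᵇ-refl : ∀ n → (n ≡ᵇ n) ≡ true
≡ᵇ-refl zero    = refl
≡ᵇ-refl (suc n) = ≡ᵇ-refl n

≡ᵇ-false : ∀ {m n} → m ≢ n → (m ≡ᵇ n) ≡ false
≡ᵇ-false {m} {n} m≢n = dec-false (m ℕ.≟ n) m≢n

contract-pivot : ∀ R p q j → contract R p q p j ≡ (j ≡ᵇ q)
contract-pivot R p q j rewrite ≡ᵇ-refl p = refl

contract-other : ∀ R {p} q {i} j → i ≢ p → contract R p q i j ≡ R (suc i) (suc j)
contract-other R q j i≢p rewrite ≡ᵇ-false i≢p = refl

insert-follows : ∀ {m} R (c : Code m) p →
  let q = toℕ (follow c p) in
  (c , p) Follows R ⇔ (T (passes R (toℕ p) q) × c Follows contract R (toℕ p) q)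
insert-follows {m} R c p = mk⇔ to from
  where
  q = toℕ (follow c p)

  to : (c , p) Follows R → T (passes R (toℕ p) q) × c Follows contract R (toℕ p) q
  to f = Equivalence.from T-∧ (subst (λ x → T (R (toℕ (suc p)) (toℕ x))) (follow-pivot c p) (f (suc p)) , f zero) , edge
    where
    edge : c Follows contract R (toℕ p) q
    edge i with i ≟ p
    ... | yes refl = subst T (sym (trans (contract-pivot R (toℕ p) q q) (≡ᵇ-refl q))) tt
    ... | no i≢p   = subst T (sym (contract-other R q (toℕ (follow c i)) (i≢p ∘ toℕ-injective)))
                       (subst (λ x → T (R (toℕ (suc i)) (toℕ x))) (follow-other c i≢p) (f (suc i)))

  from : T (passes R (toℕ p) q) × c Follows contract R (toℕ p) q → (c , p) Follows R
  from (pass , g) zero    = proj₂ (Equivalence.to (T-∧ {x = R (suc (toℕ p)) 0}) pass)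
  from (pass , g) (suc i) = edge (i ≟ p)
    where
    edge : Dec (i ≡ p) → T (R (toℕ (suc i)) (toℕ (follow (c , p) (suc i))))
    edge (yes refl) = subst (λ x → T (R (toℕ (suc p)) (toℕ x))) (sym (follow-pivot c p)) (proj₁ (Equivalence.to T-∧ pass))
    edge (no i≢p)   = subst (λ x → T (R (toℕ (suc i)) (toℕ x))) (sym (follow-other c i≢p))
                        (subst T (contract-other R q (toℕ (follow c i)) (i≢p ∘ toℕ-injective)) (g i))

⟨∧⟩ : ∀ x y → ⟨ x ∧ y ⟩ ≡ ⟨ x ⟩ * ⟨ y ⟩
⟨∧⟩ true  y = sym (ℤ.*-identityˡ ⟨ y ⟩)
⟨∧⟩ false y = refl

-- Contraction at `(p , q)` forces `q` to come after `p`, so only the term with `q` equal to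
-- `follow c p` survives. Summing over all `q` frees this index from `c`, so that the sum over `c`
-- can be taken inside.
follows-insert : ∀ {m} R (c : Code m) p → ⟨ does (follows? R (c , p)) ⟩ ≡
  sum {suc m} (λ q → ⟨ passes R (toℕ p) (toℕ q) ⟩ * ⟨ does (follows? (contract R (toℕ p) (toℕ q)) c) ⟩)
follows-insert {m} R c p = begin
  ⟨ does (follows? R (c , p)) ⟩
    ≡⟨ cong ⟨_⟩ (does-⇔ (insert-follows R c p) (follows? R (c , p)) (T? (passes R p′ q) ×-dec follows? (contract R p′ q) c)) ⟩
  ⟨ passes R p′ q ∧ does (follows? (contract R p′ q) c) ⟩       ≡⟨ ⟨∧⟩ (passes R p′ q) _ ⟩
  ⟨ passes R p′ q ⟩ * ⟨ does (follows? (contract R p′ q) c) ⟩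
    ≡⟨ sum-single (follow c p) (λ q → ⟨ passes R p′ (toℕ q) ⟩ * ⟨ does (follows? (contract R p′ (toℕ q)) c) ⟩) off ⟨
  sum {suc m} (λ q → ⟨ passes R p′ (toℕ q) ⟩ * ⟨ does (follows? (contract R p′ (toℕ q)) c) ⟩) ∎
  where
  p′ = toℕ p
  q  = toℕ (follow c p)
  off : ∀ r → r ≢ follow c p → ⟨ passes R p′ (toℕ r) ⟩ * ⟨ does (follows? (contract R p′ (toℕ r)) c) ⟩ ≡ 0ℤ
  off r r≢q rewrite dec-false (follows? (contract R p′ (toℕ r)) c) (λ f →
      subst T (trans (contract-pivot R p′ (toℕ r) q) (≡ᵇ-false (≢-sym r≢q ∘ toℕ-injective))) (f p))
    = ℤ.*-zeroʳ ⟨ passes R p′ (toℕ r) ⟩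

-- Sums over lists.

module _ {X : Set} where

  sumOver : List X → (X → ℤ) → ℤ
  sumOver []       f = 0ℤ
  sumOver (x ∷ xs) f = f x + sumOver xs f

  sumOver-cong : ∀ xs {f g : X → ℤ} → f ≗ g → sumOver xs f ≡ sumOver xs g
  sumOver-cong []       f≗g = refl
  sumOver-cong (x ∷ xs) f≗g = cong₂ _+_ (f≗g x) (sumOver-cong xs f≗g)

  sumOver-++ : ∀ xs ys (f : X → ℤ) → sumOver (xs List.++ ys) f ≡ sumOver xs f + sumOver ys f
  sumOver-++ []       ys f = sym (ℤ.+-identityˡ _)
  sumOver-++ (x ∷ xs) ys f = trans (cong (_+_ (f x)) (sumOver-++ xs ys f)) (sym (ℤ.+-assoc (f x) (sumOver xs f) (sumOver ys f)))

  sumOver-* : ∀ xs k (f : X → ℤ) → sumOver xs (λ x → k * f x) ≡ k * sumOver xs f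
  sumOver-* []       k f = sym (ℤ.*-zeroʳ k)
  sumOver-* (x ∷ xs) k f = trans (cong (_+_ (k * f x)) (sumOver-* xs k f)) (sym (ℤ.*-distribˡ-+ k (f x) _))

  sumOver-sum : ∀ xs {n} (f : Fin n → X → ℤ) → sumOver xs (λ x → sum (λ i → f i x)) ≡ sum (λ i → sumOver xs (f i))
  sumOver-sum []       {n} f = sym (sum-zero {n} (λ _ → refl))
  sumOver-sum (x ∷ xs) {n} f = trans (cong (_+_ (sum (λ i → f i x))) (sumOver-sum xs f)) (sym (∑-distrib-+ {n = n} _ _))

  sumOver-tabulate : ∀ {n} (g : Fin n → X) (f : X → ℤ) → sumOver (tabulate g) f ≡ sum (f ∘ g)
  sumOver-tabulate {zero}  g f = refl
  sumOver-tabulate {suc n} g f = cong (_+_ (f (g zero))) (sumOver-tabulate (g ∘ suc) f)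

  length-filter : ∀ {P : X → Set} (P? : Unary.Decidable P) xs → + length (filter P? xs) ≡ sumOver xs (λ x → ⟨ does (P? x) ⟩)
  length-filter P? []       = refl
  length-filter P? (x ∷ xs) with does (P? x)
  ... | true  = cong (_+_ 1ℤ) (length-filter P? xs)
  ... | false = trans (length-filter P? xs) (sym (ℤ.+-identityˡ _))

sumOver-map : ∀ {X Y : Set} (g : X → Y) xs f → sumOver (List.map g xs) f ≡ sumOver xs (f ∘ g)
sumOver-map g []       f = refl
sumOver-map g (x ∷ xs) f = cong (_+_ (f (g x))) (sumOver-map g xs f)

sumOver-× : ∀ {X Y : Set} (xs : List X) (ys : List Y) f →
            sumOver (cartesianProduct xs ys) f ≡ sumOver xs (λ x → sumOver ys (λ y → f (x , y)))
sumOver-× []       ys f = refl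
sumOver-× (x ∷ xs) ys f = trans (sumOver-++ (List.map (x ,_) ys) _ f) (cong₂ _+_ (sumOver-map (x ,_) ys f) (sumOver-× xs ys f))

-- The number of cycles and its contraction formula.

cycles : ∀ m → Digraph → ℤ
cycles m R = sumOver (codes m) (λ c → ⟨ does (follows? R c) ⟩)

cycles-contract : ∀ m R → cycles (suc m) R ≡
  sum {suc m} (λ p → sum {suc m} (λ q → ⟨ passes R (toℕ p) (toℕ q) ⟩ * cycles m (contract R (toℕ p) (toℕ q))))
cycles-contract m R = begin
  cycles (suc m) R
    ≡⟨ sumOver-× (codes m) (allFin (suc m)) (λ c → ⟨ does (follows? R c) ⟩) ⟩
  sumOver (codes m) (λ c → sumOver (allFin (suc m)) (λ p → ⟨ does (follows? R (c , p)) ⟩))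
    ≡⟨ sumOver-cong (codes m) (λ c → trans (sumOver-tabulate id (λ p → ⟨ does (follows? R (c , p)) ⟩)) (sum-cong-≗ (follows-insert R c))) ⟩
  sumOver (codes m) (λ c → sum {suc m} (λ p → sum {suc m} (λ q → weight p q * indicator p q c)))
    ≡⟨ sumOver-sum (codes m) {suc m} (λ p c → sum {suc m} (λ q → weight p q * indicator p q c)) ⟩
  sum {suc m} (λ p → sumOver (codes m) (λ c → sum {suc m} (λ q → weight p q * indicator p q c)))
    ≡⟨ sum-cong-≗ {suc m} (λ p → trans (sumOver-sum (codes m) {suc m} (λ q c → weight p q * indicator p q c)) (sum-cong-≗ {suc m} (λ q → sumOver-* (codes m) (weight p q) (indicator p q)))) ⟩
  sum {suc m} (λ p → sum {suc m} (λ q → weight p q * cycles m (contract R (toℕ p) (toℕ q)))) ∎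
  where
  weight : (p q : Fin (suc m)) → ℤ
  weight p q = ⟨ passes R (toℕ p) (toℕ q) ⟩
  indicator : (p q : Fin (suc m)) → Code m → ℤ
  indicator p q c = ⟨ does (follows? (contract R (toℕ p) (toℕ q)) c) ⟩

cycles-cong : ∀ m {R R′} → (∀ i j → R i j ≡ R′ i j) → cycles m R ≡ cycles m R′
cycles-cong m {R} {R′} R≗R′ = sumOver-cong (codes m) λ c → cong ⟨_⟩
  (does-⇔ (mk⇔ (λ f i → subst T (R≗R′ _ _) (f i)) (λ f i → subst T (sym (R≗R′ _ _)) (f i))) (follows? R c) (follows? R′ c))

sum-truncate : ∀ {m n} (f : ℕ → ℤ) → m ≤ n → (∀ i → m ≤ i → f i ≡ 0ℤ) →
               sum {n} (f ∘ toℕ) ≡ sum {m} (f ∘ toℕ)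
sum-truncate {n = n} f z≤n       f≗0 = sum-zero {n} (λ i → f≗0 (toℕ i) z≤n)
sum-truncate         f (s≤s m≤n) f≗0 = cong (_+_ (f 0)) (sum-truncate (f ∘ suc) m≤n (λ i m≤i → f≗0 (suc i) (s≤s m≤i)))

-- The transfer matrix on window digraphs.

module Transfer {a b : ℕ} (a<b : a < b) where

  edge : Digraph
  edge i j = (∣ i - j ∣ ≡ᵇ a) ∨ (∣ i - j ∣ ≡ᵇ b)

  width : ℕ
  width = b ℕ.+ b

  -- Contraction rewrites a row `p` with an arc from `suc p` to 0, hence `p < b`; an edge out of a
  -- row below `b` ends before `2b`. So a window of `b` rows and `width` columns holds every
  -- alteration.
  Local : Digraph → Set
  Local R = ∀ i j → b ≤ i ⊎ width ≤ j → R i j ≡ edge i j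

  edge-long : ∀ i j → b < ∣ i - j ∣ → edge i j ≡ false
  edge-long i j b<d = cong₂ _∨_ (≡ᵇ-false (ℕ.>⇒≢ (ℕ.<-trans a<b b<d))) (≡ᵇ-false (ℕ.>⇒≢ b<d))

  window-long : ∀ {i j} → i < b → width ≤ j → b < ∣ i - j ∣
  window-long {i} {j} i<b w≤j = subst (b <_) (sym (ℕ.m≤n⇒∣m-n∣≡n∸m i≤j)) (ℕ.m+n≤o⇒m≤o∸n (suc b) 1+b+i≤j)
    where
    1+b+i≤j : suc b ℕ.+ i ≤ j
    1+b+i≤j = ℕ.≤-trans (ℕ.≤-reflexive (sym (ℕ.+-suc b i))) (ℕ.≤-trans (ℕ.+-monoʳ-≤ b i<b) w≤j)
    i≤j : i ≤ j
    i≤j = ℕ.≤-trans (ℕ.m≤n+m i (suc b)) 1+b+i≤j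

  -- Off row `p`, removing 0 and renumbering is harmless because `edge` depends on differences only.
  -- In row `p`, beyond the window, both sides are false: `q` lies inside it, and an edge from `p`
  -- does not reach that far.
  contract-local : ∀ {R p q} → p < b → q < width → Local R → Local (contract R p q)
  contract-local {R} {p} {q} p<b q<w local i j far with i ℕ.≟ p
  -- `edge (suc i) (suc j)` computes to `edge i j`.
  ... | no i≢p   = trans (contract-other R q j i≢p) (local (suc i) (suc j) (shifted far))
    where
    shifted : b ≤ i ⊎ width ≤ j → b ≤ suc i ⊎ width ≤ suc j
    shifted (inj₁ b≤i) = inj₁ (ℕ.m≤n⇒m≤1+n b≤i)
    shifted (inj₂ w≤j) = inj₂ (ℕ.m≤n⇒m≤1+n w≤j)
  contract-local {R} {p} {q} p<b q<w local i j (inj₁ b≤i) | yes refl = contradiction p<b (ℕ.≤⇒≯ b≤i)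
  contract-local {R} {p} {q} p<b q<w local i j (inj₂ w≤j) | yes refl =
    trans (contract-pivot R p q j)
      (trans (≡ᵇ-false (ℕ.>⇒≢ (ℕ.<-≤-trans q<w w≤j))) (sym (edge-long i j (window-long p<b w≤j))))

  passes-far : ∀ {R p q} → Local R → b ≤ p ⊎ width ≤ q → passes R p q ≡ false
  passes-far {R} {p} {q} local (inj₁ b≤p) =
    cong (_∧ R 0 (suc q)) (trans (local (suc p) 0 (inj₁ (ℕ.m≤n⇒m≤1+n b≤p))) (edge-long (suc p) 0 (s≤s b≤p)))
  passes-far {R} {p} {q} local (inj₂ w≤q) =
    trans (cong (R (suc p) 0 ∧_) (trans (local 0 (suc q) (inj₂ (ℕ.m≤n⇒m≤1+n w≤q)))
      (edge-long 0 (suc q) (s≤s (ℕ.≤-trans (ℕ.m≤m+n b b) w≤q))))) (∧-zeroʳ (R (suc p) 0))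

  -- The ranges of `p` and `q` no longer depend on `m`, which makes the linear system finite. The
  -- bound `width ≤ suc m` ensures that every position of the window is a vertex.
  cycles-contract-local : ∀ {m R} → Local R → width ≤ suc m → cycles (suc m) R ≡
    sum {b} (λ p → sum {width} (λ q → ⟨ passes R (toℕ p) (toℕ q) ⟩ * cycles m (contract R (toℕ p) (toℕ q))))
  cycles-contract-local {m} {R} local w≤1+m = begin
    cycles (suc m) R                                          ≡⟨ cycles-contract m R ⟩
    sum {suc m} (λ p → sum {suc m} (λ q → term (toℕ p) (toℕ q)))
      ≡⟨ sum-cong-≗ {suc m} (λ p → sum-truncate (term (toℕ p)) w≤1+m (λ q w≤q → vanishes (toℕ p) q (inj₂ w≤q))) ⟩
    sum {suc m} (λ p → sum {width} (λ q → term (toℕ p) (toℕ q)))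
      ≡⟨ sum-truncate (λ p → sum {width} (λ q → term p (toℕ q))) (ℕ.≤-trans (ℕ.m≤m+n b b) w≤1+m) (λ p b≤p → sum-zero {width} (λ q → vanishes p (toℕ q) (inj₁ b≤p))) ⟩
    sum {b} (λ p → sum {width} (λ q → term (toℕ p) (toℕ q))) ∎
    where
    term : ℕ → ℕ → ℤ
    term p q = ⟨ passes R p q ⟩ * cycles m (contract R p q)
    vanishes : ∀ p q → b ≤ p ⊎ width ≤ q → term p q ≡ 0ℤ
    vanishes p q far = cong (λ x → ⟨ x ⟩ * cycles m (contract R p q)) (passes-far {R} local far)

  -- A local digraph is determined by its window, `b` rows of `width` bits; the exponents follow
  -- that nesting, so that `funToFin` numbers the windows.
  States : ℕ
  States = (2 ^ width) ^ b

  bit : Bool → Fin 2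
  bit false = zero
  bit true  = suc zero

  unbit : Fin 2 → Bool
  unbit zero       = false
  unbit (suc zero) = true

  unbit-bit : ∀ x → unbit (bit x) ≡ x
  unbit-bit false = refl
  unbit-bit true  = refl

  decode : Fin States → Digraph
  decode t i j with i ℕ.<? b | j ℕ.<? width
  ... | yes i<b | yes j<w = unbit (finToFun {2} {width} (finToFun {2 ^ width} {b} t (fromℕ< i<b)) (fromℕ< j<w))
  ... | yes _   | no _    = edge i j
  ... | no _    | _       = edge i j

  encode : Digraph → Fin States
  encode R = funToFin {b} {2 ^ width} (λ i → funToFin {width} {2} (λ j → bit (R (toℕ i) (toℕ j))))

  decode-local : ∀ t → Local (decode t)
  decode-local t i j far with i ℕ.<? b | j ℕ.<? width
  decode-local t i j (inj₁ b≤i) | yes i<b | yes j<w = contradiction i<b (ℕ.≤⇒≯ b≤i)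
  decode-local t i j (inj₂ w≤j) | yes i<b | yes j<w = contradiction j<w (ℕ.≤⇒≯ w≤j)
  ... | yes _   | no _    = refl
  ... | no _    | _       = refl

  decode-encode : ∀ {R} → Local R → ∀ i j → decode (encode R) i j ≡ R i j
  decode-encode {R} local i j with i ℕ.<? b | j ℕ.<? width
  ... | yes i<b | yes j<w = begin
    unbit (finToFun {2} {width} (finToFun {2 ^ width} {b} (encode R) i′) j′)
      ≡⟨ cong (λ r → unbit (finToFun {2} {width} r j′)) (finToFun-funToFin (λ i → funToFin {width} {2} (λ j → bit (R (toℕ i) (toℕ j)))) i′) ⟩
    unbit (finToFun {2} {width} (funToFin {width} {2} (λ j → bit (R (toℕ i′) (toℕ j)))) j′)
      ≡⟨ cong unbit (finToFun-funToFin (λ j → bit (R (toℕ i′) (toℕ j))) j′) ⟩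
    unbit (bit (R (toℕ i′) (toℕ j′))) ≡⟨ unbit-bit _ ⟩
    R (toℕ i′) (toℕ j′)               ≡⟨ cong₂ R (toℕ-fromℕ< i<b) (toℕ-fromℕ< j<w) ⟩
    R i j                             ∎
    where
    i′ = fromℕ< i<b
    j′ = fromℕ< j<w
  ... | yes _   | no j≮w  = sym (local i j (inj₂ (ℕ.≮⇒≥ j≮w)))
  ... | no i≮b  | _       = sym (local i j (inj₁ (ℕ.≮⇒≥ i≮b)))

  successor : Fin States → Fin b → Fin width → Fin States
  successor t p q = encode (contract (decode t) (toℕ p) (toℕ q))

  -- Several pairs `(p , q)` may lead to the same state, so the entries are counts. They do not
  -- depend on `m`, which gives the system constant coefficients.
  transfer : Fin States → Fin States → ℤ
  transfer t u = sum {b} (λ p → sum {width} (λ q → ⟨ passes (decode t) (toℕ p) (toℕ q) ⟩ * δ (successor t p q) u))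

  cycles-transfer : ∀ t m → width ≤ suc m →
    cycles (suc m) (decode t) ≡ sum (λ u → transfer t u * cycles m (decode u))
  cycles-transfer t m w≤1+m = begin
    cycles (suc m) (decode t)
      ≡⟨ cycles-contract-local (decode-local t) w≤1+m ⟩
    sum {b} (λ p → sum {width} (λ q → w p q * cycles m (contract (decode t) (toℕ p) (toℕ q))))
      ≡⟨ sum-cong-≗ {b} (λ p → sum-cong-≗ {width} (λ q → cong (w p q *_) (reencode p q))) ⟩
    sum {b} (λ p → sum {width} (λ q → w p q * x (successor t p q)))
      ≡⟨ sum-cong-≗ {b} (λ p → sum-cong-≗ {width} (λ q → expand p q)) ⟩
    sum {b} (λ p → sum {width} (λ q → sum {States} (λ u → w p q * δ (successor t p q) u * x u)))
      ≡⟨ sum-cong-≗ {b} (λ p → ∑-comm {width} {States} (λ q u → w p q * δ (successor t p q) u * x u)) ⟩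
    sum {b} (λ p → sum {States} (λ u → sum {width} (λ q → w p q * δ (successor t p q) u * x u)))
      ≡⟨ ∑-comm {b} {States} (λ p u → sum {width} (λ q → w p q * δ (successor t p q) u * x u)) ⟩
    sum {States} (λ u → sum {b} (λ p → sum {width} (λ q → w p q * δ (successor t p q) u * x u)))
      ≡⟨ sum-cong-≗ {States} (λ u → collect u) ⟩
    sum {States} (λ u → transfer t u * x u) ∎
    where
    w : Fin b → Fin width → ℤ
    w p q = ⟨ passes (decode t) (toℕ p) (toℕ q) ⟩
    x : Fin States → ℤ
    x u = cycles m (decode u)

    reencode : ∀ p q → cycles m (contract (decode t) (toℕ p) (toℕ q)) ≡ x (successor t p q)
    reencode p q = sym (cycles-cong m (decode-encode (contract-local {decode t} (toℕ<n p) (toℕ<n q) (decode-local t))))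

    expand : ∀ p q → w p q * x (successor t p q) ≡ sum {States} (λ u → w p q * δ (successor t p q) u * x u)
    expand p q = begin
      w p q * x (successor t p q)                                     ≡⟨ cong (w p q *_) (sum-δ (successor t p q) x) ⟨
      w p q * sum {States} (λ u → δ (successor t p q) u * x u)
        ≡⟨ *-distribˡ-sum {States} (w p q) (λ u → δ (successor t p q) u * x u) ⟩
      sum {States} (λ u → w p q * (δ (successor t p q) u * x u))
        ≡⟨ sum-cong-≗ {States} (λ u → ℤ.*-assoc (w p q) (δ (successor t p q) u) (x u)) ⟨
      sum {States} (λ u → w p q * δ (successor t p q) u * x u)        ∎

    collect : ∀ u → sum {b} (λ p → sum {width} (λ q → w p q * δ (successor t p q) u * x u)) ≡ transfer t u * x u
    collect u = sym (trans (*-distribʳ-sum {b} (x u) (λ p → sum {width} (λ q → w p q * δ (successor t p q) u)))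
      (sum-cong-≗ {b} (λ p → *-distribʳ-sum {width} (x u) (λ q → w p q * δ (successor t p q) u))))

  -- Starting the sequence at `width` makes the transfer step valid at every index.
  cycles-recurrent : ∀ {R} → Local R → Recurrent (λ k → cycles (k ℕ.+ width) R)
  cycles-recurrent {R} local with D , v , 1≤D , rec ← linear-recurrent transfer {λ t k → cycles (k ℕ.+ width) (decode t)}
      (λ t k → cycles-transfer t (k ℕ.+ width) (ℕ.m≤n⇒m≤1+n (ℕ.m≤n+m width k))) (encode R)
    = D , v , 1≤D , λ k → trans (sym (same (k ℕ.+ D))) (trans (rec k) (⟦⟧-cong v same k))
    where
    same : ∀ k → cycles (k ℕ.+ width) (decode (encode R)) ≡ cycles (k ℕ.+ width) R
    same k = cycles-cong (k ℕ.+ width) (decode-encode local)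

-- Cyclic maps, rotations and reflections of the circle.

-- `transitive` expresses a single orbit as an induction principle: what is closed under `t` and
-- holds somewhere holds everywhere.
record Cyclic {n} (t : Fin n → Fin n) : Set₁ where
  field
    injective  : ∀ {x y} → t x ≡ t y → x ≡ y
    transitive : ∀ (P : Fin n → Set) → (∀ x → P x → P (t x)) → ∀ {x} → P x → ∀ y → P y

open Cyclic

module _ {m : ℕ} where

  private
    n = suc m

  toℕ-next : (i : Fin n) → toℕ (next i) ≡ suc (toℕ i) % n
  toℕ-next i = toℕ-fromℕ< _

  next-inject₁ : (i : Fin m) → next (inject₁ i) ≡ suc i
  next-inject₁ i = toℕ-injective (begin
    toℕ (next (inject₁ i))      ≡⟨ toℕ-next (inject₁ i) ⟩
    suc (toℕ (inject₁ i)) % n   ≡⟨ cong (λ k → suc k % n) (toℕ-inject₁ i) ⟩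
    suc (toℕ i) % n             ≡⟨ m<n⇒m%n≡m (s≤s (toℕ<n i)) ⟩
    suc (toℕ i)                 ∎)

  next-fromℕ : next (fromℕ m) ≡ zero
  next-fromℕ = toℕ-injective (begin
    toℕ (next (fromℕ m))        ≡⟨ toℕ-next (fromℕ m) ⟩
    suc (toℕ (fromℕ m)) % n     ≡⟨ cong (λ k → suc k % n) (toℕ-fromℕ m) ⟩
    n % n                       ≡⟨ n%n≡0 n ⟩
    0                           ∎)

  opposite-inject₁ : ∀ {k} (i : Fin k) → opposite (inject₁ i) ≡ suc (opposite i)
  opposite-inject₁ zero    = refl
  opposite-inject₁ (suc i) = cong inject₁ (opposite-inject₁ i)

  opposite-fromℕ : ∀ k → opposite (fromℕ k) ≡ zero
  opposite-fromℕ k = opposite-involutive (zero {k})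

  -- Reversal conjugates `next` to its inverse. This yields the injectivity of `next` and the facts
  -- about reflections below.
  next-opposite-next : (i : Fin n) → next (opposite (next i)) ≡ opposite i
  next-opposite-next i with view i
  ... | ‵fromℕ      rewrite next-fromℕ | opposite-fromℕ m = next-fromℕ
  ... | ‵inject₁ j  rewrite next-inject₁ j | opposite-inject₁ j = next-inject₁ (opposite j)

  next-cyclic : Cyclic (next {n})
  next-cyclic .injective {x} {y} eq = begin
    x                                 ≡⟨ undo x ⟨
    opposite (next (opposite (next x))) ≡⟨ cong (λ z → opposite (next (opposite z))) eq ⟩
    opposite (next (opposite (next y))) ≡⟨ undo y ⟩
    y                                 ∎
    where
    undo : ∀ z → opposite (next (opposite (next z))) ≡ z
    undo z = trans (cong opposite (next-opposite-next z)) (opposite-involutive z)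
  -- From `x` climb to the top place, wrap around to `zero`, then climb from `zero` to any place.
  next-cyclic .transitive P closed {x} Px = <-weakInduction P (start x Px)
      (λ i Pi → subst P (next-inject₁ i) (closed _ Pi))
    where
    start : ∀ x → P x → P zero
    start = >-weakInduction (λ x → P x → P zero) (λ Pm → subst P next-fromℕ (closed _ Pm))
      (λ i ih Pi → ih (subst P (next-inject₁ i) (closed _ Pi)))

  %-absorb : ∀ x y → (x ℕ.+ y % n) % n ≡ (x ℕ.+ y) % n
  %-absorb x y = begin
    (x ℕ.+ y % n) % n               ≡⟨ %-distribˡ-+ x (y % n) n ⟩
    (x % n ℕ.+ y % n % n) % n       ≡⟨ cong (λ z → (x % n ℕ.+ z) % n) (m%n%n≡m%n y n) ⟩
    (x % n ℕ.+ y % n) % n           ≡⟨ %-distribˡ-+ x y n ⟨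
    (x ℕ.+ y) % n                   ∎

  toℕ-⊕ : (k i : Fin n) → toℕ (k ⊕ i) ≡ (toℕ k ℕ.+ toℕ i) % n
  toℕ-⊕ k i = toℕ-fromℕ< _

  ⊕-comm : (k i : Fin n) → k ⊕ i ≡ i ⊕ k
  ⊕-comm k i = toℕ-injective (trans (toℕ-⊕ k i) (trans (cong (_% n) (ℕ.+-comm (toℕ k) (toℕ i))) (sym (toℕ-⊕ i k))))

  ⊕-identityʳ : (k : Fin n) → k ⊕ zero ≡ k
  ⊕-identityʳ k = toℕ-injective (begin
    toℕ (k ⊕ zero)      ≡⟨ toℕ-⊕ k zero ⟩
    (toℕ k ℕ.+ 0) % n   ≡⟨ cong (_% n) (ℕ.+-identityʳ (toℕ k)) ⟩
    toℕ k % n           ≡⟨ m<n⇒m%n≡m (toℕ<n k) ⟩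
    toℕ k               ∎)

  ⊕-next : (k i : Fin n) → k ⊕ next i ≡ next (k ⊕ i)
  ⊕-next k i = toℕ-injective (begin
    toℕ (k ⊕ next i)                    ≡⟨ toℕ-⊕ k (next i) ⟩
    (toℕ k ℕ.+ toℕ (next i)) % n        ≡⟨ cong (λ z → (toℕ k ℕ.+ z) % n) (toℕ-next i) ⟩
    (toℕ k ℕ.+ suc (toℕ i) % n) % n     ≡⟨ %-absorb (toℕ k) (suc (toℕ i)) ⟩
    (toℕ k ℕ.+ suc (toℕ i)) % n         ≡⟨ cong (_% n) (ℕ.+-suc (toℕ k) (toℕ i)) ⟩
    (1 ℕ.+ (toℕ k ℕ.+ toℕ i)) % n       ≡⟨ %-absorb 1 (toℕ k ℕ.+ toℕ i) ⟨
    (1 ℕ.+ (toℕ k ℕ.+ toℕ i) % n) % n   ≡⟨ cong (λ z → suc z % n) (toℕ-⊕ k i) ⟨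
    suc (toℕ (k ⊕ i)) % n               ≡⟨ toℕ-next (k ⊕ i) ⟨
    toℕ (next (k ⊕ i))                  ∎)

  next-⊕ : (k i : Fin n) → next k ⊕ i ≡ next (k ⊕ i)
  next-⊕ k i = trans (⊕-comm (next k) i) (trans (⊕-next i k) (cong next (⊕-comm i k)))

  ⊕-surjective : (k j : Fin n) → ∃ λ i → k ⊕ i ≡ j
  ⊕-surjective k = transitive next-cyclic (λ j → ∃ λ i → k ⊕ i ≡ j)
    (λ j (i , eq) → next i , trans (⊕-next k i) (cong next eq)) (zero , ⊕-identityʳ k)

  next-surjective : (j : Fin n) → ∃ λ i → next i ≡ j
  next-surjective j = opposite (next (opposite j)) , trans (next-opposite-next (opposite j)) (opposite-involutive j)

  -- The rotation `l` is by `-k` modulo `n`. Induction around the circle produces it without modular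
  -- subtraction, each step of `k` moving `l` back by one place.
  opposite-⊕ : (k : Fin n) → ∃ λ l → ∀ i → opposite (k ⊕ i) ≡ l ⊕ opposite i
  opposite-⊕ = transitive next-cyclic _ step {zero}
    (zero , λ i → trans (cong opposite (zero-⊕ i)) (sym (zero-⊕ (opposite i))))
    where
    zero-⊕ : ∀ i → zero ⊕ i ≡ i
    zero-⊕ i = trans (⊕-comm zero i) (⊕-identityʳ i)

    step : ∀ k → (∃ λ l → ∀ i → opposite (k ⊕ i) ≡ l ⊕ opposite i) →
           ∃ λ l → ∀ i → opposite (next k ⊕ i) ≡ l ⊕ opposite i
    step k (l , eq) with l′ , refl ← next-surjective l = l′ , λ i → injective next-cyclic {opposite (next k ⊕ i)} {l′ ⊕ opposite i} (begin
      next (opposite (next k ⊕ i))    ≡⟨ cong (next ∘ opposite) (next-⊕ k i) ⟩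
      next (opposite (next (k ⊕ i)))  ≡⟨ next-opposite-next (k ⊕ i) ⟩
      opposite (k ⊕ i)                ≡⟨ eq i ⟩
      next l′ ⊕ opposite i            ≡⟨ next-⊕ l′ (opposite i) ⟩
      next (l′ ⊕ opposite i)          ∎)

  ⊕-opposite : (k : Fin n) → ∃ λ l → ∀ i → k ⊕ opposite i ≡ opposite (l ⊕ i)
  ⊕-opposite k with l , opp ← opposite-⊕ k = l , λ i → begin
    k ⊕ opposite i                              ≡⟨ opposite-involutive (k ⊕ opposite i) ⟨
    opposite (opposite (k ⊕ opposite i))        ≡⟨ cong opposite (opp (opposite i)) ⟩
    opposite (l ⊕ opposite (opposite i))        ≡⟨ cong (λ j → opposite (l ⊕ j)) (opposite-involutive i) ⟩
    opposite (l ⊕ i)                            ∎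

  Forward : Arrangement n → (Fin n → Fin n) → Set
  Forward σ t = ∀ i → t (σ i) ≡ σ (next i)

  -- The map is read off in one direction or the other. Invariance under `∼` lets a class of
  -- necklaces be matched with a directed cycle.
  Traces : Arrangement n → (Fin n → Fin n) → Set
  Traces σ t = Forward σ t ⊎ Forward (σ ∘ opposite) t

  -- Two readings of the same map agree everywhere once they agree at one place; `k` is the place in
  -- `σ` of the first entry of `τ`.
  forward-rotation : ∀ {σ τ t} → Forward σ t → Forward τ t → EachOnce σ → ∃ λ k → ∀ i → τ i ≡ σ (k ⊕ i)
  forward-rotation {σ} {τ} {t} fσ fτ once with k , σk≡τ0 , _ ← once (τ zero) = k ,
    transitive next-cyclic (λ i → τ i ≡ σ (k ⊕ i))
      (λ i eq → begin
        τ (next i)       ≡⟨ fτ i ⟨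
        t (τ i)          ≡⟨ cong t eq ⟩
        t (σ (k ⊕ i))    ≡⟨ fσ (k ⊕ i) ⟩
        σ (next (k ⊕ i)) ≡⟨ cong σ (⊕-next k i) ⟨
        σ (k ⊕ next i)   ∎)
      (trans (sym σk≡τ0) (cong σ (sym (⊕-identityʳ k))))

  rotation-forward : ∀ {σ τ t} k → (∀ i → τ i ≡ σ (k ⊕ i)) → Forward τ t → Forward σ t
  rotation-forward {σ} {τ} {t} k eq fτ j with i , refl ← ⊕-surjective k j = begin
    t (σ (k ⊕ i))     ≡⟨ cong t (eq i) ⟨
    t (τ i)           ≡⟨ fτ i ⟩
    τ (next i)        ≡⟨ eq (next i) ⟩
    σ (k ⊕ next i)    ≡⟨ cong σ (⊕-next k i) ⟩
    σ (next (k ⊕ i))  ∎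

  once-injective : ∀ {σ : Arrangement n} → EachOnce σ → ∀ {i j} → σ i ≡ σ j → i ≡ j
  once-injective {σ} once {i} {j} eq with k , _ , unique ← once (σ j) = trans (sym (unique eq)) (unique refl)

  once : ∀ {σ : Arrangement n} → (∀ {i j} → σ i ≡ σ j → i ≡ j) → (∀ x → ∃ λ i → σ i ≡ x) → EachOnce σ
  once inj surj x with i , eq ← surj x = i , eq , λ eq′ → inj (trans eq (sym eq′))

  once-opposite : ∀ {σ : Arrangement n} → EachOnce σ → EachOnce (σ ∘ opposite)
  once-opposite {σ} o = once
    (λ {i} {j} eq → trans (sym (opposite-involutive i)) (trans (cong opposite (once-injective o eq)) (opposite-involutive j)))
    λ x → let i , eq , _ = o x in opposite i , trans (cong σ (opposite-involutive i)) eq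

  -- A backward reading is replaced by its reflection, the two readings are aligned by a rotation,
  -- and `opposite` is then moved across that rotation.
  traces-∼ : ∀ {σ τ} t → EachOnce σ → Traces σ t → Traces τ t → σ ∼ τ
  traces-∼ {σ} {τ} t o (inj₁ fσ) (inj₁ fτ) with k , eq ← forward-rotation {σ} {τ} {t} fσ fτ o = k , inj₁ eq
  traces-∼ {σ} {τ} t o (inj₁ fσ) (inj₂ fτ) with k , eq ← forward-rotation {σ} {τ ∘ opposite} {t} fσ fτ o =
    k , inj₂ λ i → trans (cong τ (sym (opposite-involutive i))) (eq (opposite i))
  traces-∼ {σ} {τ} t o (inj₂ fσ) (inj₁ fτ) with k , eq ← forward-rotation {σ ∘ opposite} {τ} {t} fσ fτ (once-opposite o)
    with l , opp ← opposite-⊕ k =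
    l , inj₂ λ i → trans (eq i) (cong σ (opp i))
  traces-∼ {σ} {τ} t o (inj₂ fσ) (inj₂ fτ) with k , eq ← forward-rotation {σ ∘ opposite} {τ ∘ opposite} {t} fσ fτ (once-opposite o)
    with l , opp ← opposite-⊕ k =
    l , inj₁ λ i → begin
      τ i                                   ≡⟨ cong τ (opposite-involutive i) ⟨
      τ (opposite (opposite i))             ≡⟨ eq (opposite i) ⟩
      σ (opposite (k ⊕ opposite i))         ≡⟨ cong σ (opp (opposite i)) ⟩
      σ (l ⊕ opposite (opposite i))         ≡⟨ cong (λ j → σ (l ⊕ j)) (opposite-involutive i) ⟩
      σ (l ⊕ i)                             ∎

  ∼-traces : ∀ {σ τ} t → σ ∼ τ → Traces τ t → Traces σ t
  ∼-traces {σ} {τ} t (k , inj₁ eq) (inj₁ fτ) = inj₁ (rotation-forward {σ} {τ} {t} k eq fτ)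
  ∼-traces {σ} {τ} t (k , inj₁ eq) (inj₂ fτ) with l , opp ← ⊕-opposite k =
    inj₂ (rotation-forward {σ ∘ opposite} {τ ∘ opposite} {t} l (λ i → trans (eq (opposite i)) (cong σ (opp i))) fτ)
  ∼-traces {σ} {τ} t (k , inj₂ eq) (inj₁ fτ) with l , opp ← ⊕-opposite k =
    inj₂ (rotation-forward {σ ∘ opposite} {τ} {t} l (λ i → trans (eq i) (cong σ (opp i))) fτ)
  ∼-traces {σ} {τ} t (k , inj₂ eq) (inj₂ fτ) =
    inj₁ (rotation-forward {σ} {τ ∘ opposite} {t} k (λ i → trans (eq (opposite i)) (cong (λ j → σ (k ⊕ j)) (opposite-involutive i))) fτ)

  -- The map is `next` conjugated by `σ`, and so inherits injectivity and the single orbit.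
  once-cyclic : ∀ {σ : Arrangement n} → EachOnce σ → ∃ λ t → Cyclic t × Forward σ t
  once-cyclic {σ} o = t , cyc , forward
    where
    place : Fin n → Fin n
    place x = proj₁ (o x)

    σ-place : ∀ x → σ (place x) ≡ x
    σ-place x = proj₁ (proj₂ (o x))

    t : Fin n → Fin n
    t x = σ (next (place x))

    forward : Forward σ t
    forward i = cong (σ ∘ next) (once-injective o (σ-place (σ i)))

    cyc : Cyclic t
    cyc .injective {x} {y} eq = begin
      x           ≡⟨ σ-place x ⟨
      σ (place x) ≡⟨ cong σ (injective next-cyclic (once-injective o eq)) ⟩
      σ (place y) ≡⟨ σ-place y ⟩
      y           ∎
    cyc .transitive P closed {x} Px y = subst P (σ-place y)
      (transitive next-cyclic (P ∘ σ) (λ i Pσi → subst P (forward i) (closed (σ i) Pσi)) (subst P (sym (σ-place x)) Px) (place y))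

  module _ {t : Fin n → Fin n} (cyc : Cyclic t) where

    walk : ℕ → Fin n
    walk zero    = zero
    walk (suc k) = t (walk k)

    walk-cancel : ∀ i d → walk (i ℕ.+ d) ≡ walk i → walk d ≡ zero
    walk-cancel zero    d eq = eq
    walk-cancel (suc i) d eq = walk-cancel i d (injective cyc eq)

    -- The vertices visited before the return form a set closed under `t`, hence are all the
    -- vertices; choosing for each vertex a time below `r` at which it is visited is injective.
    walk-return : ∀ r → 1 ≤ r → walk r ≡ zero → n ≤ r
    walk-return (suc r) _ back = Fin.injective⇒≤ {f = proj₁ ∘ index}
        (λ {x} {y} eq → trans (sym (proj₂ (index x))) (trans (cong (walk ∘ toℕ) eq) (proj₂ (index y))))
      where
      step : ∀ x → (∃ λ (i : Fin (suc r)) → walk (toℕ i) ≡ x) → ∃ λ (i : Fin (suc r)) → walk (toℕ i) ≡ t x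
      step x (i , refl) with view i
      ... | ‵fromℕ     = zero , trans (sym back) (cong (t ∘ walk) (sym (toℕ-fromℕ r)))
      ... | ‵inject₁ j = suc j , cong (t ∘ walk) (sym (toℕ-inject₁ j))

      index : ∀ x → ∃ λ (i : Fin (suc r)) → walk (toℕ i) ≡ x
      index = transitive cyc _ step (zero , refl)

    walk-gap : ∀ {i j} → i < j → walk i ≡ walk j → n ≤ j ∸ i × walk (j ∸ i) ≡ zero
    walk-gap {i} {j} i<j eq = walk-return (j ∸ i) (ℕ.m<n⇒0<n∸m i<j) back , back
      where
      back : walk (j ∸ i) ≡ zero
      back = walk-cancel i (j ∸ i) (trans (cong walk (ℕ.m+[n∸m]≡n (ℕ.<⇒≤ i<j))) (sym eq))

    -- Two of the times from 0 to `n` meet the same vertex. Their difference is a return time, at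
    -- most `n` by its range and at least `n` by `walk-return`.
    walk-n : walk n ≡ zero
    walk-n with i , j , i<j , eq ← Fin.pigeonhole (ℕ.n<1+n n) (walk ∘ toℕ) with n≤d , back ← walk-gap i<j eq =
      subst (λ d → walk d ≡ zero) (ℕ.≤-antisym (ℕ.≤-trans (ℕ.m∸n≤m (toℕ j) (toℕ i)) (ℕ.≤-pred (toℕ<n j))) n≤d) back

    cyclic-once : ∃ λ σ → EachOnce σ × Forward σ t
    cyclic-once = σ , once inj surj , forward
      where
      σ : Arrangement n
      σ = walk ∘ toℕ

      forward : Forward σ t
      forward i with view i
      ... | ‵fromℕ     rewrite next-fromℕ | toℕ-fromℕ m = walk-n
      ... | ‵inject₁ j rewrite next-inject₁ j | toℕ-inject₁ j = refl

      surj : ∀ x → ∃ λ i → σ i ≡ x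
      surj = transitive cyc _ (λ { x (i , refl) → next i , sym (forward i) }) (zero , refl)

      distinct : ∀ {i j : Fin n} → toℕ i < toℕ j → σ i ≢ σ j
      -- A coincidence would be a return in fewer than `n` steps.
      distinct {i} {j} i<j eq = contradiction (proj₁ (walk-gap i<j eq)) (ℕ.<⇒≱ (ℕ.≤-<-trans (ℕ.m∸n≤m (toℕ j) (toℕ i)) (toℕ<n j)))

      inj : ∀ {i j} → σ i ≡ σ j → i ≡ j
      inj {i} {j} eq with Fin.<-cmp i j
      ... | tri< i<j _ _ = contradiction eq (distinct i<j)
      ... | tri≈ _ i≡j _ = i≡j
      ... | tri> _ _ i>j = contradiction (sym eq) (distinct i>j)

-- Codes as successor maps of cycles.

-- For the single orbit: a property closed under the longer cycle is, on the vertices `suc i`,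
-- closed under the shorter one, because the step out of `p` can take the detour through `zero`.
follow-cyclic : ∀ {m} (c : Code m) → Cyclic (follow c)
follow-cyclic {zero} _ .injective eq = eq
follow-cyclic {zero} _ .transitive P closed {zero} P0 zero = P0
follow-cyclic {suc m} (c , p) .injective {zero} {zero} eq = refl
follow-cyclic {suc m} (c , p) .injective {zero} {suc j} eq with j ≟ p
... | no j≢p = contradiction (sym (injective (follow-cyclic c) (Fin.suc-injective eq))) j≢p
follow-cyclic {suc m} (c , p) .injective {suc i} {zero} eq with i ≟ p
... | no i≢p = contradiction (injective (follow-cyclic c) (Fin.suc-injective eq)) i≢p
follow-cyclic {suc m} (c , p) .injective {suc i} {suc j} eq with i ≟ p | j ≟ p
... | yes refl | yes refl = refl
... | no _     | no _     = cong suc (injective (follow-cyclic c) (Fin.suc-injective eq))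
follow-cyclic {suc m} (c , p) .transitive P closed {x} Px = everywhere
  where
  closed′ : ∀ i → P (suc i) → P (suc (follow c i))
  closed′ i Pi with i ≟ p
  ... | yes refl = closed zero (subst P (follow-pivot c p) (closed (suc p) Pi))
  ... | no i≢p   = subst P (follow-other c i≢p) (closed (suc i) Pi)

  start : ∀ x → P x → ∃ λ i → P (suc i)
  start zero    P0 = follow c p , closed zero P0
  start (suc i) Pi = i , Pi

  P-suc : ∀ i → P (suc i)
  P-suc = transitive (follow-cyclic c) (P ∘ suc) closed′ (proj₂ (start x Px))

  everywhere : ∀ y → P y
  everywhere zero    = subst P (follow-pivot c p) (closed (suc p) (P-suc p))
  everywhere (suc i) = P-suc i

-- `p` is recovered from the predecessor of `zero`, and the value of `follow c` at `p` from the
-- successor of `zero`.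
follow-unique : ∀ {m} (c d : Code m) → follow c ≗ follow d → c ≡ d
follow-unique {zero}  _       _       _  = refl
follow-unique {suc m} (c , p) (d , q) eq with p ≟ q
... | no p≢q   = contradiction (trans (sym (follow-pivot c p)) (trans (eq (suc p)) (follow-other d p≢q))) λ ()
... | yes refl = cong (_, p) (follow-unique c d eq′)
  where
  eq′ : follow c ≗ follow d
  eq′ i with i ≟ p
  ... | yes refl = Fin.suc-injective (eq zero)
  ... | no i≢p   = Fin.suc-injective (trans (sym (follow-other c i≢p)) (trans (eq (suc i)) (follow-other d i≢p)))

-- With `t zero ≡ suc q`, a step of `t` into `zero` is sent on to the successor of `zero`.
redirect : ∀ {n} → Fin n → Fin (suc n) → Fin n
redirect q zero    = q
redirect q (suc i) = i

-- Insertion is undone: `zero` is cut out, its predecessor and successor are joined, and the shorter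
-- cycle is coded by induction.
cyclic-code : ∀ {m} {t : Fin (suc m) → Fin (suc m)} → Cyclic t → ∃ λ c → follow c ≗ t
cyclic-code {zero}  {t} cyc = tt , λ { zero → eq (t zero) }
  where
  eq : ∀ (x : Fin 1) → zero ≡ x
  eq zero = refl
cyclic-code {suc m} {t} cyc with t zero in t0
-- A fixed point would be an orbit of its own, yet there are at least two vertices.
... | zero = contradiction (transitive cyc (_≡ zero) (λ { _ refl → t0 }) refl (suc zero)) λ ()
-- Every value of `t` has a preimage, so orbit induction gives one for `zero`.
... | suc q with transitive cyc (λ y → ∃ λ x → t x ≡ y) (λ y _ → y , refl) (zero , refl) zero
... | zero  , tp = contradiction (trans (sym t0) tp) λ ()
... | suc p , tp = (proj₁ code , p) , eq′
  where
  t′ : Fin (suc m) → Fin (suc m)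
  t′ i = redirect q (t (suc i))

  t′-injective : ∀ {i j} → t′ i ≡ t′ j → i ≡ j
  t′-injective {i} {j} eq with t (suc i) in ti | t (suc j) in tj
  t′-injective eq    | zero  | zero  = Fin.suc-injective (injective cyc (trans ti (sym tj)))
  t′-injective refl  | zero  | suc _ = contradiction (injective cyc (trans t0 (sym tj))) λ ()
  t′-injective refl  | suc _ | zero  = contradiction (injective cyc (trans t0 (sym ti))) λ ()
  t′-injective refl  | suc _ | suc _ = Fin.suc-injective (injective cyc (trans ti (sym tj)))

  cyc′ : Cyclic t′
  cyc′ .injective = t′-injective
  -- `zero` is assigned the property at its successor `q`, so that passing through `zero` preserves
  -- it.
  cyc′ .transitive P closed {x} Px y = transitive cyc (P ∘ redirect q) closed′ {suc x} Px (suc y)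
    where
    closed′ : ∀ x → P (redirect q x) → P (redirect q (t x))
    closed′ zero    Pq = subst (P ∘ redirect q) (sym t0) Pq
    closed′ (suc i) Pi = closed i Pi

  code : ∃ λ c → follow c ≗ t′
  code = cyclic-code cyc′

  eq′ : follow (proj₁ code , p) ≗ t
  eq′ zero    = trans (cong suc (trans (proj₂ code p) (cong (redirect q) tp))) (sym t0)
  eq′ (suc i) with i ≟ p
  ... | yes refl = sym tp
  ... | no i≢p   = trans (cong suc (proj₂ code i)) (suc-redirect (t (suc i)) refl)
    where
    suc-redirect : ∀ x → t (suc i) ≡ x → suc (redirect q x) ≡ x
    suc-redirect zero    ti = contradiction (Fin.suc-injective (injective cyc (trans ti (sym tp)))) i≢p
    suc-redirect (suc _) _  = refl

-- Lists without repetition and their lengths.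

codes-complete : ∀ m (c : Code m) → c ∈ codes m
codes-complete zero    tt      = here refl
codes-complete (suc m) (c , p) = ∈-cartesianProduct⁺ (codes-complete m c) (∈-allFin p)

codes-unique : ∀ m → Unique (codes m)
codes-unique zero    = [] ∷ []
codes-unique (suc m) = Unique.cartesianProduct⁺ (codes-unique m) (Unique.allFin⁺ (suc m))

AllPairs-lookup : ∀ {X : Set} {_#_ : X → X → Set} {xs} → AllPairs _#_ xs → ∀ i j → toℕ i < toℕ j → lookup xs i # lookup xs j
AllPairs-lookup {xs = x ∷ xs} (x# ∷ _)  zero    (suc j) _         = All.lookup x# (∈-lookup j)
AllPairs-lookup {xs = x ∷ xs} (_ ∷ pairs) (suc i) (suc j) (s≤s i<j) = AllPairs-lookup pairs i j i<j

-- The positions of `xs` inject into those of `ys`. The relations `Q` and `#` are left general so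
-- that this serves both inequivalent arrangements and distinct codes.
length-≤ : ∀ {X Y : Set} {_#_ : X → X → Set} (Q : X → Y → Set) {xs ys} → AllPairs _#_ xs →
           (∀ {x} → x ∈ xs → ∃ λ y → y ∈ ys × Q x y) →
           (∀ {x x′ y} → x ∈ xs → x′ ∈ xs → y ∈ ys → Q x y → Q x′ y → ¬ x # x′) →
           length xs ≤ length ys
length-≤ {Y = Y} Q {xs} {ys} pairs image separates = Fin.injective⇒≤ {f = place} injective-place
  where
  y∈ : ∀ i → ∃ λ y → y ∈ ys × Q (lookup xs i) y
  y∈ i = image (∈-lookup {xs = xs} i)

  place : Fin (length xs) → Fin (length ys)
  place i = Any.index (proj₁ (proj₂ (y∈ i)))

  same : ∀ {i j} → place i ≡ place j → proj₁ (y∈ i) ≡ proj₁ (y∈ j)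
  same {i} {j} eq = trans (Any.lookup-index (proj₁ (proj₂ (y∈ i))))
    (trans (cong (lookup ys) eq) (sym (Any.lookup-index (proj₁ (proj₂ (y∈ j))))))

  distinct : ∀ {i j} → toℕ i < toℕ j → place i ≢ place j
  distinct {i} {j} i<j eq = separates (∈-lookup i) (∈-lookup j) (proj₁ (proj₂ (y∈ j)))
    (subst (Q (lookup xs i)) (same eq) (proj₂ (proj₂ (y∈ i)))) (proj₂ (proj₂ (y∈ j))) (AllPairs-lookup pairs i j i<j)

  injective-place : ∀ {i j} → place i ≡ place j → i ≡ j
  injective-place {i} {j} eq with Fin.<-cmp i j
  ... | tri< i<j _ _ = contradiction eq (distinct i<j)
  ... | tri≈ _ i≡j _ = i≡j
  ... | tri> _ _ i>j = contradiction (sym eq) (distinct i>j)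

deduplicate-pairs : ∀ {X : Set} {_≈_ : X → X → Set} (_≈?_ : Decidable _≈_) xs →
                    AllPairs (λ x y → ¬ x ≈ y) (deduplicate _≈?_ xs)
deduplicate-pairs _≈?_ []       = []
deduplicate-pairs _≈?_ (x ∷ xs) = All.all-filter (¬? ∘ (x ≈?_)) (deduplicate _≈?_ xs)
                                  ∷ AllPairs.filter⁺ (¬? ∘ (x ≈?_)) (deduplicate-pairs _≈?_ xs)

deduplicate-∈ : ∀ {X : Set} {_≈_ : X → X → Set} (_≈?_ : Decidable _≈_) {xs x} →
                x ∈ deduplicate _≈?_ xs → x ∈ xs
deduplicate-∈ _≈?_ {xs} = All.lookup (All.deduplicate⁺ _≈?_ {xs = xs} (All.tabulate id))

-- An element that is dropped hands `P` on to the earlier one that displaced it.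
deduplicate-representative : ∀ {X : Set} {_≈_ : X → X → Set} (_≈?_ : Decidable _≈_) {P : X → Set} →
                             (∀ {x y} → x ≈ y → P y → P x) → ∀ {xs x} → x ∈ xs → P x →
                             ∃ λ y → y ∈ deduplicate _≈?_ xs × P y
deduplicate-representative _≈?_ resp x∈ Px = find (Any.deduplicate⁺ _≈?_ resp (lose x∈ Px))

-- The two reading directions of a necklace.

-- Otherwise `j` and `next j` would make up the whole circle, which has at least three places.
next-next : ∀ {k} (j : Fin (3 ℕ.+ k)) → next (next j) ≢ j
next-next {k} j eq = absurd (near zero) (near (suc zero)) (near (suc (suc zero)))
  where
  near : ∀ y → y ≡ j ⊎ y ≡ next j
  near = transitive next-cyclic _ (λ { y (inj₁ refl) → inj₂ refl ; y (inj₂ refl) → inj₁ eq }) (inj₁ refl)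

  absurd : ∀ {x y} → zero {2 ℕ.+ k} ≡ x ⊎ zero ≡ y → suc zero ≡ x ⊎ suc zero ≡ y →
           suc (suc zero) ≡ x ⊎ suc (suc zero) ≡ y → ⊥
  absurd (inj₁ refl) (inj₂ refl) (inj₁ ())
  absurd (inj₁ refl) (inj₂ refl) (inj₂ ())
  absurd (inj₂ refl) (inj₁ refl) (inj₁ ())
  absurd (inj₂ refl) (inj₁ refl) (inj₂ ())

-- The neighbours of `x` on its two sides would coincide, which `next-next` rules out.
directions-differ : ∀ {k} {σ : Arrangement (3 ℕ.+ k)} t t′ → EachOnce σ →
                    Forward σ t → Forward (σ ∘ opposite) t′ → ∀ x → t x ≢ t′ x
directions-differ {σ = σ} t t′ o f f′ x eq with j , refl , _ ← o x = next-next j (begin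
  next (next j)                           ≡⟨ cong next (once-injective o (begin
    σ (next j)                              ≡⟨ f j ⟨
    t (σ j)                                 ≡⟨ eq ⟩
    t′ (σ j)                                ≡⟨ cong (t′ ∘ σ) (opposite-involutive j) ⟨
    t′ (σ (opposite (opposite j)))          ≡⟨ f′ (opposite j) ⟩
    σ (opposite (next (opposite j)))        ∎)) ⟩
  next (opposite (next (opposite j)))     ≡⟨ next-opposite-next (opposite j) ⟩
  opposite (opposite j)                   ≡⟨ opposite-involutive j ⟩
  j                                       ∎)

forward-unique : ∀ {m} {σ : Arrangement (suc m)} t t′ → EachOnce σ → Forward σ t → Forward σ t′ → t ≗ t′
forward-unique t t′ o f f′ x with j , refl , _ ← o x = trans (f j) (sym (f′ j))

-- Necklaces as oriented Hamiltonian cycles.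

module Count {a b : ℕ} (a<b : a < b) where

  open Transfer a<b

  0<b : 0 < b
  0<b = ℕ.≤-<-trans z≤n a<b

  -- The neighbours of 0 are a and b, so each cycle has exactly one orientation in
  -- which 0 is followed by a.
  oriented : Digraph
  oriented zero    j = j ≡ᵇ a
  oriented (suc i) j = edge (suc i) j

  oriented-local : Local oriented
  oriented-local (suc i) j far        = refl
  oriented-local zero    j (inj₁ b≤0) = contradiction (ℕ.<-≤-trans 0<b b≤0) (ℕ.<-irrefl refl)
  oriented-local zero    j (inj₂ w≤j) =
    trans (≡ᵇ-false (ℕ.>⇒≢ (ℕ.<-≤-trans a<b (ℕ.≤-trans (ℕ.m≤m+n b b) w≤j))))
      (sym (edge-long 0 j (window-long 0<b w≤j)))

  edge⇒adjacent : ∀ i j → T (edge i j) → Adjacent a b i j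
  edge⇒adjacent i j e with Equivalence.to (T-∨ {∣ i - j ∣ ≡ᵇ a}) e
  ... | inj₁ e = inj₁ (ℕ.≡ᵇ⇒≡ ∣ i - j ∣ a e)
  ... | inj₂ e = inj₂ (ℕ.≡ᵇ⇒≡ ∣ i - j ∣ b e)

  adjacent⇒edge : ∀ i j → Adjacent a b i j → T (edge i j)
  adjacent⇒edge i j (inj₁ eq) = Equivalence.from (T-∨ {∣ i - j ∣ ≡ᵇ a}) (inj₁ (ℕ.≡⇒≡ᵇ ∣ i - j ∣ a eq))
  adjacent⇒edge i j (inj₂ eq) = Equivalence.from (T-∨ {∣ i - j ∣ ≡ᵇ a}) (inj₂ (ℕ.≡⇒≡ᵇ ∣ i - j ∣ b eq))

  adjacent-sym : ∀ {i j} → Adjacent a b i j → Adjacent a b j i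
  adjacent-sym {i} {j} = subst (λ d → d ≡ a ⊎ d ≡ b) (ℕ.∣-∣-comm i j)

  oriented⇒adjacent : ∀ i j → T (oriented i j) → Adjacent a b i j
  oriented⇒adjacent zero    j e = inj₁ (ℕ.≡ᵇ⇒≡ j a e)
  oriented⇒adjacent (suc i) j e = edge⇒adjacent (suc i) j e

  Connected : ∀ {n} → Arrangement n → Set
  Connected σ = ∀ i → Adjacent a b (toℕ (σ i)) (toℕ (σ (next i)))

  connected-opposite : ∀ {m} {σ : Arrangement (suc m)} → Connected σ → Connected (σ ∘ opposite)
  connected-opposite {σ = σ} adj i = adjacent-sym {toℕ (σ (opposite (next i)))}
    (subst (λ j → Adjacent a b (toℕ (σ (opposite (next i)))) (toℕ (σ j))) (next-opposite-next i) (adj (opposite (next i))))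

  adjacent-forward : ∀ {m} {σ : Arrangement (suc m)} t → EachOnce σ → Connected σ → Forward σ t →
                     ∀ x → Adjacent a b (toℕ x) (toℕ (t x))
  adjacent-forward {σ = σ} t o adj f x with j , refl , _ ← o x =
    subst (λ y → Adjacent a b (toℕ (σ j)) (toℕ y)) (sym (f j)) (adj j)

  oriented-code : ∀ {m} {σ : Arrangement (suc m)} t → EachOnce σ → Connected σ → Cyclic t → Forward σ t →
                  toℕ (t zero) ≡ a → ∃ λ c → c Follows oriented × Forward σ (follow c)
  oriented-code {σ = σ} t o adj cyc f t0≡a with c , eq ← cyclic-code cyc =
    c , follows , λ i → trans (eq (σ i)) (f i)
    where
    follows : c Follows oriented
    follows zero    = ℕ.≡⇒≡ᵇ _ a (trans (cong toℕ (eq zero)) t0≡a)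
    follows (suc i) = subst (λ y → T (edge (suc (toℕ i)) (toℕ y))) (sym (eq (suc i)))
      (adjacent⇒edge (suc (toℕ i)) (toℕ (t (suc i))) (adjacent-forward t o adj f (suc i)))

  -- The two neighbours of 0 on the circle differ and each is `a` or `b`. Thus `a` follows 0 in one
  -- reading direction, and the successor map of that direction is coded.
  necklace-code : ∀ {k} {σ : Arrangement (3 ℕ.+ k)} → IsNecklace a b σ →
                  ∃ λ c → c Follows oriented × Traces σ (follow c)
  necklace-code {σ = σ} (o , adj)
    with t , cyc , f ← once-cyclic o | t′ , cyc′ , f′ ← once-cyclic (once-opposite o)
    with adjacent-forward t o adj f zero | adjacent-forward t′ (once-opposite o) (connected-opposite {σ = σ} adj) f′ zero
  ... | inj₁ t0≡a | _ with c , follows , g ← oriented-code t o adj cyc f t0≡a = c , follows , inj₁ g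
  ... | inj₂ t0≡b | inj₂ t′0≡b = contradiction (toℕ-injective (trans t0≡b (sym t′0≡b))) (directions-differ t t′ o f f′ zero)
  ... | inj₂ _    | inj₁ t′0≡a with c , follows , g ← oriented-code t′ (once-opposite o) (connected-opposite {σ = σ} adj) cyc′ f′ t′0≡a =
    c , follows , inj₂ g

  -- Both cycles send 0 to `a`, so they trace `σ` in the same direction, in which `σ` determines the
  -- successor map.
  traces-unique : ∀ {k} {σ : Arrangement (3 ℕ.+ k)} → EachOnce σ → ∀ {c d} → c Follows oriented → d Follows oriented →
                  Traces σ (follow c) → Traces σ (follow d) → c ≡ d
  traces-unique {σ = σ} o {c} {d} fc fd = cases
    where
    agree : follow c zero ≡ follow d zero
    agree = toℕ-injective (trans (ℕ.≡ᵇ⇒≡ _ a (fc zero)) (sym (ℕ.≡ᵇ⇒≡ _ a (fd zero))))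

    cases : Traces σ (follow c) → Traces σ (follow d) → c ≡ d
    cases (inj₁ f) (inj₁ g) = follow-unique c d (forward-unique (follow c) (follow d) o f g)
    cases (inj₂ f) (inj₂ g) = follow-unique c d (forward-unique (follow c) (follow d) (once-opposite o) f g)
    cases (inj₁ f) (inj₂ g) = contradiction agree (directions-differ (follow c) (follow d) o f g zero)
    cases (inj₂ f) (inj₁ g) = contradiction (sym agree) (directions-differ (follow d) (follow c) o g f zero)

  necklaces : ∀ n → List (Arrangement n)
  necklaces n = filter (isNecklace? a b) (arrangements n)

  code-necklace : ∀ {m} {c : Code m} → c Follows oriented →
                  ∃ λ σ → σ ∈ necklaces (suc m) × Forward σ (follow c)
  code-necklace {m} {c} follows with σ , o , f ← cyclic-once (follow-cyclic c) =
    τ , ∈-filter⁺ (isNecklace? a b) (∈-map⁺ finToFun (∈-allFin (funToFin σ))) (o′ , adj) , f′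
    where
    τ : Arrangement (suc m)
    -- List membership is up to propositional equality, so the arrangement found in the list is this
    -- pointwise equal copy of `σ`.
    τ = finToFun (funToFin σ)

    τ≗σ : τ ≗ σ
    τ≗σ = finToFun-funToFin σ

    o′ : EachOnce τ
    o′ x with i , eq , unique ← o x = i , trans (τ≗σ i) eq , λ eq′ → unique (trans (sym (τ≗σ _)) eq′)

    f′ : Forward τ (follow c)
    f′ i = trans (cong (follow c) (τ≗σ i)) (trans (f i) (sym (τ≗σ (next i))))

    adj : Connected τ
    adj i = subst (λ y → Adjacent a b (toℕ (τ i)) (toℕ y)) (f′ i) (oriented⇒adjacent (toℕ (τ i)) _ (follows (τ i)))

  -- Both inequalities go through `Traces`: arrangements that trace a common code are equivalent,
  -- and an arrangement traces only one oriented code.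
  class-count : ∀ {k} (ds : List (Arrangement (3 ℕ.+ k))) (cs : List (Code (2 ℕ.+ k))) →
    AllPairs (λ σ τ → ¬ σ ∼ τ) ds → Unique cs →
    (∀ {σ} → σ ∈ ds → IsNecklace a b σ) → (∀ {c} → c Follows oriented → ∃ λ σ → σ ∈ ds × Traces σ (follow c)) →
    (∀ {c} → c ∈ cs → c Follows oriented) → (∀ {c} → c Follows oriented → c ∈ cs) →
    length ds ≡ length cs
  class-count ds cs inequivalent unique necklace realised follows complete = ℕ.≤-antisym
    (length-≤ (λ σ c → Traces σ (follow c)) inequivalent
      (λ σ∈ → let c , fc , T = necklace-code (necklace σ∈) in c , complete fc , T)
      (λ {_} {_} {c} σ∈ _ _ Tσ Tτ σ≁τ → σ≁τ (traces-∼ (follow c) (proj₁ (necklace σ∈)) Tσ Tτ)))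
    (length-≤ (λ c σ → Traces σ (follow c)) unique
      (λ c∈ → realised (follows c∈))
      (λ c∈ d∈ σ∈ Tc Td c≢d → c≢d (traces-unique (proj₁ (necklace σ∈)) (follows c∈) (follows d∈) Tc Td)))

  N-cycles : ∀ k → + N a b (3 ℕ.+ k) ≡ cycles (2 ℕ.+ k) oriented
  N-cycles k = trans (cong +_ (class-count (deduplicate _∼?_ (necklaces n)) (filter (follows? oriented) (codes m))
      (deduplicate-pairs _∼?_ (necklaces n))
      (Unique.filter⁺ (follows? oriented) (codes-unique m))
      (λ σ∈ → proj₂ (∈-filter⁻ (isNecklace? a b) {xs = arrangements n} (deduplicate-∈ _∼?_ {necklaces n} σ∈)))
      (λ {c} fc → let σ , σ∈ , f = code-necklace {c = c} fc in
        deduplicate-representative (_∼?_ {n}) {λ τ → Traces τ (follow c)}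
          (λ {σ} {τ} → ∼-traces {σ = σ} {τ} (follow c)) {necklaces n} σ∈ (inj₁ f))
      (λ c∈ → proj₂ (∈-filter⁻ (follows? oriented) {xs = codes m} c∈))
      (λ {c} fc → ∈-filter⁺ (follows? oriented) (codes-complete m c) fc)))
    (length-filter (follows? oriented) (codes m))
    where
    -- `Code m` describes cycles on `suc m` vertices, hence the shift by one.
    m = 2 ℕ.+ k
    n = 3 ℕ.+ k

-- From the cycle counts to the recurrence for necklaces.

recurrence-from : ∀ (F G : ℕ → ℤ) w → 2 ≤ w → (∀ k → F (3 ℕ.+ k) ≡ G (2 ℕ.+ k)) → Recurrent (λ k → G (k ℕ.+ w)) →
  ∃[ d ] ∃[ n₀ ] Σ[ c ∈ (Fin d → ℤ) ] (1 ≤ d) × (d ℕ.+ 3 ≤ n₀) ×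
    (∀ n → n₀ ≤ n → F n ≡ sum (λ i → c i * F (n ∸ suc (toℕ i))))
recurrence-from F G w 2≤w F≡G (D , v , 1≤D , rec) =
  -- `v` lists coefficients by increasing shift while the recurrence counts back from `n`, hence
  -- `opposite`. The bound is at least `suc (D + w)`, from where the recurrence is available, and at
  -- least `D + 3`, which keeps all terms at lengths 3 or more.
  D , D ℕ.+ 3 ℕ.+ w , Vec.lookup v ∘ opposite , 1≤D , ℕ.m≤m+n (D ℕ.+ 3) w , recurrence
  where
  y : Sequence
  y k = G (k ℕ.+ w)

  F≡y : ∀ k → F (suc (k ℕ.+ w)) ≡ y k
  -- `2 ≤ w` lets `k + w` be written as `2 + (k + w - 2)`, the form in which `F` and `G` are
  -- compared.
  F≡y k = subst (λ m → F (suc m) ≡ G m) (ℕ.m+[n∸m]≡n (ℕ.≤-trans 2≤w (ℕ.m≤n+m w k))) (F≡G (k ℕ.+ w ∸ 2))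

  recurrence : ∀ n → D ℕ.+ 3 ℕ.+ w ≤ n → F n ≡ sum (λ i → Vec.lookup v (opposite i) * F (n ∸ suc (toℕ i)))
  recurrence n n₀≤n = begin
    F n                                                                ≡⟨ cong F n≡ ⟩
    F (suc (k ℕ.+ D ℕ.+ w))                                            ≡⟨ F≡y (k ℕ.+ D) ⟩
    y (k ℕ.+ D)                                                        ≡⟨ rec k ⟩
    ⟦ v ⟧ y k                                                          ≡⟨ ⟦⟧-as-sum v y k ⟩
    sum (λ i → Vec.lookup v i * y (k ℕ.+ toℕ i))
      ≡⟨ sum-permute (λ i → Vec.lookup v i * y (k ℕ.+ toℕ i)) Perm.reverse ⟩
    sum (λ i → Vec.lookup v (opposite i) * y (k ℕ.+ toℕ (opposite i)))
      ≡⟨ sum-cong-≗ (λ i → cong (Vec.lookup v (opposite i) *_) (term i)) ⟩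
    sum (λ i → Vec.lookup v (opposite i) * F (n ∸ suc (toℕ i)))        ∎
    where
    k : ℕ
    k = n ∸ suc (D ℕ.+ w)

    bound : suc (D ℕ.+ w) ≤ n
    bound = ℕ.≤-trans (ℕ.+-monoˡ-≤ w (subst (suc D ≤_) (ℕ.+-comm 3 D) (s≤s (ℕ.m≤n+m D 2)))) n₀≤n

    n≡ : n ≡ suc (k ℕ.+ D ℕ.+ w)
    n≡ = begin
      n                       ≡⟨ ℕ.m∸n+n≡m bound ⟨
      k ℕ.+ suc (D ℕ.+ w)     ≡⟨ ℕ.+-suc k (D ℕ.+ w) ⟩
      suc (k ℕ.+ (D ℕ.+ w))   ≡⟨ cong suc (ℕ.+-assoc k D w) ⟨
      suc (k ℕ.+ D ℕ.+ w)     ∎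

    term : ∀ i → y (k ℕ.+ toℕ (opposite i)) ≡ F (n ∸ suc (toℕ i))
    term i = trans (sym (F≡y (k ℕ.+ toℕ (opposite i)))) (cong F (begin
      suc (k ℕ.+ toℕ (opposite i) ℕ.+ w)        ≡⟨ cong (λ l → suc (k ℕ.+ l ℕ.+ w)) (opposite-prop i) ⟩
      suc (k ℕ.+ (D ∸ suc (toℕ i)) ℕ.+ w)       ≡⟨ cong (λ l → suc (l ℕ.+ w)) (ℕ.+-∸-assoc k (Fin.toℕ<n i)) ⟨
      suc (k ℕ.+ D ∸ suc (toℕ i) ℕ.+ w)         ≡⟨ cong suc (ℕ.+-∸-comm w i<k+D) ⟨
      suc (k ℕ.+ D ℕ.+ w ∸ suc (toℕ i))         ≡⟨ ℕ.+-∸-assoc 1 (ℕ.≤-trans i<k+D (ℕ.m≤m+n (k ℕ.+ D) w)) ⟨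
      suc (k ℕ.+ D ℕ.+ w) ∸ suc (toℕ i)         ≡⟨ cong (_∸ suc (toℕ i)) n≡ ⟨
      n ∸ suc (toℕ i)                           ∎))
      where
      i<k+D : toℕ i < k ℕ.+ D
      i<k+D = ℕ.≤-trans (Fin.toℕ<n i) (ℕ.m≤n+m D k)

corollary4p12 : ∀ (a b : ℕ) → 0 < a → a < b → Coprime a b →
    ∃[ d ] ∃[ n₀ ] Σ[ c ∈ (Fin d → ℤ) ] (1 ≤ d) × (d ℕ.+ 3 ≤ n₀) ×
    (∀ n → n₀ ≤ n →
    + N a b n ≡ sum (λ i → c i * + N a b (n ∸ suc (toℕ i))))
corollary4p12 a b _ a<b _ =
  recurrence-from (λ n → + N a b n) (λ m → cycles m oriented) width (ℕ.+-mono-≤ 0<b 0<b)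
    N-cycles (cycles-recurrent oriented-local)
  where
  open Transfer a<b
  open Count a<b
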